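{- Let $\mathbb{F}$ be a field and let $\{f_n\}$ be an explicit family of multilinear polynomials over $\mathbb{F}$ such that $f_n$ is an $n$-variate polynomial of degree $d=d(n)=\omega(n/\log n)$, and any syntactically multilinear $\Sigma\Pi\Sigma\Pi$ circuit computing $f_n$ has size at least $n^{\Omega(\sqrt{d})}$. Then $\{f_n\}$ requires syntactically multilinear circuits of superpolynomial size; that is, the minimum size of a syntactically multilinear circuit computing $f_n$ is $n^{\omega(1)}$.
   Context: An algebraic circuit over a field $\mathbb{F}$ and variables $x_1,\dots,x_n$ is a directed acyclic graph whose internal vertices (gates) are labeled $+$ or $\times$ and whose leaves are labeled by variables or constants from $\mathbb{F}$; each gate computes the sum or product of the polynomials computed by its children, and the circuit computes the polynomial at its output gate. The size of a circuit is its number of edges. Fan-in is unbounded. A circuit is syntactically multilinear if at every product gate with inputs $u_1,\dots,u_t$, the sets of variables appearing in the sub-circuits rooted at $u_1,\dots,u_t$ are pairwise disjoint. A $\Sigma\Pi\Sigma\Pi$ circuit is a circuit with four layers of alternating sum and product gates of unbounded fan-in, the top (output) layer being a sum layer; inputs of gates in a layer are gates of the next layer below or leaves. Asymptotic notation is as $n\to\infty$: the lower bound hypothesis means that there is a constant $c>0$ such that for all sufficiently large $n$ every such circuit for $f_n$ has size at least $n^{c\sqrt{d(n)}}$; $d=\omega(n/\log n)$ means $d(n)\log n/n\to\infty$. The word "explicit" is an informal qualifier that is given no formal definition and imposes no formal condition here. -}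

module Defs where

open import Algebra.Apartness.Bundles using (HeytingField)
open import Data.Bool using (if_then_else_)
open import Data.Empty using (⊥)
open import Data.Fin using (Fin; zero; suc; toℕ)
open import Data.Fin.Subset using (Subset; ⁅_⁆; _∩_; Empty)
import Data.Fin.Subset as Subset
open import Data.List using (List; []; _∷_; _++_; foldr; cartesianProductWith)
open import Data.List.NonEmpty using (List⁺; toList)
import Data.List.NonEmpty as List⁺
open import Data.List.Relation.Unary.All using (All)
open import Data.List.Relation.Unary.AllPairs using (AllPairs)
open import Data.Nat using (ℕ; zero; suc; _+_; _*_; _^_; _≤_; NonZero; _≟_)
open import Data.Product using (∃-syntax; _×_; _,_)
open import Data.Sum using (_⊎_)
open import Data.Unit using (⊤)
open import Data.Vec using (Vec; []; _∷_; lookup; replicate; _[_]≔_; zipWith; sum)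
open import Data.Vec.Properties using (≡-dec)
open import Function using (_∘_)
open import Level using (Level)
open import Relation.Binary.PropositionalEquality using (_≡_)
open import Relation.Nullary using (¬_; does)

private
  variable
    ℓ : Level

Eventually : (ℕ → Set ℓ) → Set ℓ
Eventually P = ∃[ N ] (∀ n → N ≤ n → P n)

-- d(n) log n / n → ∞: for every K eventually K ≤ d(n) log₂ n / n, that is
-- 2 ^ (K n) ≤ n ^ d(n).  Neither the base of the logarithm nor the restriction
-- of K to natural numbers affects the meaning.
IsωOf-n/log-n : (ℕ → ℕ) → Set
IsωOf-n/log-n d = ∀ K → Eventually (λ n → 2 ^ (K * n) ≤ n ^ d n)

-- n ^ (c √d) ≤ s for the positive rational c = p / q.  A real power of n is the
-- supremum of the rational powers below it, so this says n ^ (a / b) ≤ s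
-- (that is, n ^ a ≤ s ^ b) for all rationals a / b ≤ (p / q) √d.
PowerOfRootBounds : (n d p q s : ℕ) → Set
PowerOfRootBounds n d p q s =
  ∀ a b → .{{NonZero b}} → (a * q) ^ 2 ≤ (p * b) ^ 2 * d → n ^ a ≤ s ^ b

-- A monomial is its vector of exponents.
Monomial : ℕ → Set
Monomial n = Vec ℕ n

data Op : Set where
  ⊕ ⊗ : Op

layerOp : Fin 4 → Op
layerOp = lookup (⊕ ∷ ⊗ ∷ ⊕ ∷ ⊗ ∷ [])

Disjoint : ∀ {n} → Subset n → Subset n → Set
Disjoint p q = Empty (p ∩ q)

module _ {c ℓ₁ ℓ₂} (F : HeytingField c ℓ₁ ℓ₂) where

  open HeytingField F using (Carrier; _≈_; 0#; 1#)
    renaming (_+_ to _+ᶠ_; _*_ to _*ᶠ_)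

  -- Formal sums of terms, in which a monomial may occur repeatedly or with
  -- coefficient zero; polynomials are identified by _≈ᴾ_.
  Polynomial : ℕ → Set c
  Polynomial n = List (Carrier × Monomial n)

  coeff : ∀ {n} → Polynomial n → Monomial n → Carrier
  coeff []            m = 0#
  coeff ((a , e) ∷ f) m =
    if does (≡-dec _≟_ e m) then a +ᶠ coeff f m else coeff f m

  infix 4 _≈ᴾ_
  _≈ᴾ_ : ∀ {n} → Polynomial n → Polynomial n → Set ℓ₁
  f ≈ᴾ g = ∀ m → coeff f m ≈ coeff g m

  constᴾ : ∀ {n} → Carrier → Polynomial n
  constᴾ {n} a = (a , replicate n 0) ∷ []

  varᴾ : ∀ {n} → Fin n → Polynomial n
  varᴾ {n} i = (1# , replicate n 0 [ i ]≔ 1) ∷ []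

  _+ᴾ_ : ∀ {n} → Polynomial n → Polynomial n → Polynomial n
  _+ᴾ_ = _++_

  _*ᴾ_ : ∀ {n} → Polynomial n → Polynomial n → Polynomial n
  _*ᴾ_ = cartesianProductWith λ (a , e) (b , e′) → a *ᶠ b , zipWith _+_ e e′

  Multilinear : ∀ {n} → Polynomial n → Set ℓ₁
  Multilinear f = ∀ m → ¬ (coeff f m ≈ 0#) → ∀ i → lookup m i ≤ 1

  HasDegree : ∀ {n} → Polynomial n → ℕ → Set ℓ₁
  HasDegree f d =
    (∃[ m ] ¬ (coeff f m ≈ 0#) × sum m ≡ d) ×
    (∀ m → ¬ (coeff f m ≈ 0#) → sum m ≤ d)

  -- A vertex of a circuit in n variables, whose children are among k vertices.
  data Node (n k : ℕ) : Set c where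
    var   : Fin n → Node n k
    const : Carrier → Node n k
    gate  : Op → List⁺ (Fin k) → Node n k

  -- A directed acyclic graph with k labelled vertices, listed in reverse
  -- topological order: the children of a vertex are found in the tail following
  -- it, vertex zero being the head of the list.  Parallel edges are allowed.
  data Graph (n : ℕ) : ℕ → Set c where
    []  : Graph n 0
    _∷_ : ∀ {k} → Node n k → Graph n k → Graph n (suc k)

  record Circuit (n : ℕ) : Set c where
    field
      {vertices} : ℕ
      graph      : Graph n vertices
      output     : Fin vertices

  open Circuit

  edges : ∀ {n k} → Graph n k → ℕ
  edges []              = 0
  edges (var _     ∷ G) = edges G
  edges (const _   ∷ G) = edges G
  edges (gate _ us ∷ G) = List⁺.length us + edges G

  size : ∀ {n} → Circuit n → ℕ
  size C = edges (graph C)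

  polynomialAt : ∀ {n k} → Graph n k → Fin k → Polynomial n
  polynomialAt (_         ∷ G) (suc v) = polynomialAt G v
  polynomialAt (var i     ∷ G) zero    = varᴾ i
  polynomialAt (const a   ∷ G) zero    = constᴾ a
  polynomialAt (gate ⊕ us ∷ G) zero    =
    foldr _+ᴾ_ (constᴾ 0#) (toList (List⁺.map (polynomialAt G) us))
  polynomialAt (gate ⊗ us ∷ G) zero    =
    foldr _*ᴾ_ (constᴾ 1#) (toList (List⁺.map (polynomialAt G) us))

  Computes : ∀ {n} → Circuit n → Polynomial n → Set ℓ₁
  Computes C f = polynomialAt (graph C) (output C) ≈ᴾ f

  variablesAt : ∀ {n k} → Graph n k → Fin k → Subset n
  variablesAt (_         ∷ G) (suc v) = variablesAt G v
  variablesAt (var i     ∷ G) zero    = ⁅ i ⁆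
  variablesAt (const _   ∷ G) zero    = Subset.⊥
  variablesAt (gate _ us ∷ G) zero    =
    Subset.⋃ (toList (List⁺.map (variablesAt G) us))

  SyntacticallyMultilinearᴳ : ∀ {n k} → Graph n k → Set
  SyntacticallyMultilinearᴳ []              = ⊤
  SyntacticallyMultilinearᴳ (var _     ∷ G) = SyntacticallyMultilinearᴳ G
  SyntacticallyMultilinearᴳ (const _   ∷ G) = SyntacticallyMultilinearᴳ G
  SyntacticallyMultilinearᴳ (gate ⊕ _  ∷ G) = SyntacticallyMultilinearᴳ G
  SyntacticallyMultilinearᴳ (gate ⊗ us ∷ G) =
    AllPairs Disjoint (toList (List⁺.map (variablesAt G) us)) ×
    SyntacticallyMultilinearᴳ G

  SyntacticallyMultilinear : ∀ {n} → Circuit n → Set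
  SyntacticallyMultilinear C = SyntacticallyMultilinearᴳ (graph C)

  IsLeaf : ∀ {n k} → Graph n k → Fin k → Set
  IsLeaf (_        ∷ G) (suc v) = IsLeaf G v
  IsLeaf (var _    ∷ _) zero    = ⊤
  IsLeaf (const _  ∷ _) zero    = ⊤
  IsLeaf (gate _ _ ∷ _) zero    = ⊥

  -- Layers are counted from the output, so every child of a gate is a leaf or
  -- lies one layer further down; in layer 3 only leaves are possible.  The
  -- layer assigned to a leaf is irrelevant.
  LayeredBy : ∀ {n k} → (Fin k → Fin 4) → Graph n k → Set
  LayeredBy layer []              = ⊤
  LayeredBy layer (var _     ∷ G) = LayeredBy (layer ∘ suc) G
  LayeredBy layer (const _   ∷ G) = LayeredBy (layer ∘ suc) G
  LayeredBy layer (gate o us ∷ G) =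
    o ≡ layerOp (layer zero) ×
    All (λ u → IsLeaf G u ⊎ toℕ (layer (suc u)) ≡ suc (toℕ (layer zero)))
        (toList us) ×
    LayeredBy (layer ∘ suc) G

  IsΣΠΣΠ : ∀ {n} → Circuit n → Set
  IsΣΠΣΠ C = ∃[ layer ]
    LayeredBy layer (graph C) ×
    ¬ IsLeaf (graph C) (output C) × layer (output C) ≡ zero

{-# OPTIONS --safe #-}
module Submission where

open import Defs
open import Algebra.Apartness.Bundles using (HeytingField; HeytingCommutativeRing)
open import Algebra.Bundles using (CommutativeRing; CommutativeSemiring)
import Algebra.Properties.CommutativeSemigroup as CommutativeSemigroupProperties
open import Algebra.Structures.Biased using (isCommutativeSemiringˡ; isCommutativeMonoidˡ)
open import Data.Bool using (true; false; if_then_else_)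
open import Data.Empty using (⊥)
open import Data.Fin using (Fin; zero; suc; toℕ)
open import Data.Fin.Subset using (Subset; inside; outside; ⁅_⁆; _∈_; _∉_; _⊆_; _∪_; ⋃; ∣_∣; Nonempty)
import Data.Fin.Subset as Subset
import Data.Fin.Subset.Properties as Subsetₚ
open import Data.List using (List; []; _∷_; _++_; foldr; map; length; filter; cartesianProductWith)
open import Data.List.Membership.Propositional using () renaming (_∈_ to _∈ˡ_)
open import Data.List.NonEmpty as List⁺ using (List⁺; _∷_; toList)
import Data.List.Properties as Listₚ
open import Data.List.Relation.Binary.Pointwise as Pointwise using (Pointwise; []; _∷_)
open import Data.List.Relation.Unary.All as All using (All; []; _∷_)
import Data.List.Relation.Unary.All.Properties as Allₚ
open import Data.List.Relation.Unary.AllPairs as AllPairs using (AllPairs; []; _∷_)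
import Data.List.Relation.Unary.AllPairs.Properties as AllPairsₚ
open import Data.List.Relation.Unary.Any as Any using (Any; here; there)
import Data.List.Relation.Unary.Any.Properties as Anyₚ
open import Data.Maybe using (fromMaybe)
open import Data.Nat hiding (_⊔_)
open import Data.Nat.DivMod using (m≡m%n+[m/n]*n; m%n<n; m/n*n≤m)
import Data.Nat.Properties as ℕₚ
open import Data.Nat.Solver using (module +-*-Solver)
open import Data.Product using (∃-syntax; _×_; _,_; proj₁; proj₂; map₂)
open import Data.Sum using (_⊎_; inj₁; inj₂; [_,_]′)
open import Data.Unit using (⊤; tt)
open import Data.Unit.Polymorphic using () renaming (⊤ to ⊤ₗ)
open import Data.Vec as Vec using ([]; _∷_; zipWith; replicate; lookup; here; there; _[_]≔_)
import Data.Vec.Properties as Vecₚ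
open import Function using (_∘_; _on_)
open import Level using (_⊔_)
import Relation.Binary.Reasoning.Setoid as SetoidReasoning
open import Relation.Binary.PropositionalEquality as ≡ using (_≡_; _≢_; refl; cong; cong₂)
open import Relation.Binary.Structures using (IsEquivalence)
open import Relation.Nullary using (does; yes; no; ¬_; contradiction)
open import Relation.Nullary.Decidable using (dec-true; dec-false)
open import Relation.Unary using (Pred; Decidable)

-- A syntactically multilinear circuit of size s is flattened by induction on its
-- edges.  Fix a threshold t and let w be a lowest vertex depending on more than t
-- variables.  Viewing w as a fresh variable, which occurs linearly, the polynomial at
-- the output v is Z + D · P_w: here Z is computed by the circuit with w replaced by 0,
-- and D, the coefficient of w, by a circuit with fewer edges whose output avoids the
-- more than t variables of w.  As P_w is a sum or a product of polynomials in at most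
-- t variables, an n-variate output becomes a sum of at most (1 + s) ^ (n / t) products
-- of polynomials in disjoint sets of at most t variables.  Expanding each factor into
-- at most 2 ^ t monomials gives a ΣΠΣΠ circuit of size (1 + s) ^ O(n / t) · 2 ^ O(t).
-- If s < n ^ k and n / t is a small multiple of √d, the first factor is at most
-- n ^ (c √d / 2), and d = ω(n / log n) is what makes 2 ^ O(t) negligible too.

-- Let e count edges and let f be the fan-in of w. Both Z and D lose the f edges of w, and D also
-- loses more than t variables, so with r quotients left the number of terms obeys T(e, r) ≤ T(e -
-- f, r) + f · T(e - f, r - 1). The f pieces of P_w are paid for by the f edges that disappear,
-- which is why (1 + e) ^ r solves the recursion and why induction runs on edges, not vertices.
-- Multiplying D by P_w is harmless only if D avoids the variables of w. This holds because two
-- factors of one product gate cannot both depend on w: they would share the variables of w. Over a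
-- Heyting field a coefficient cannot be tested for being zero. Supports are therefore read off the
-- listed terms, cancelling ones included, and normal forms list every subset of the variables.

module _ where

  -- Numerical estimates and the choice of r and t

  open ℕₚ
  open ≤-Reasoning

  -- Each of the 2 ^ s monomials costs one edge, one for its coefficient and at most s
  -- for its variables.
  normalFormSize : ℕ → ℕ
  normalFormSize s = 2 ^ s * suc (suc s)

  -- Each inner `suc` is the wire leading to a factor or to a term, added to what lies below it. The
  -- `suc` on `T` allows for one extra summand at the output.
  depthFourSize : (T L t : ℕ) → ℕ
  depthFourSize T L t = suc T * suc (L * suc (normalFormSize t))

  normalFormSize-mono : ∀ {s t} → s ≤ t → normalFormSize s ≤ normalFormSize t
  normalFormSize-mono s≤t = *-mono-≤ (^-monoʳ-≤ 2 s≤t) (s≤s (s≤s s≤t))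

  ^-distribʳ-* : ∀ a b m → (a * b) ^ m ≡ a ^ m * b ^ m
  ^-distribʳ-* a b zero    = refl
  ^-distribʳ-* a b (suc m) = ≡.trans (cong (a * b *_) (^-distribʳ-* a b m)) (interchange a b (a ^ m) (b ^ m))
    where open CommutativeSemigroupProperties *-commutativeSemigroup using (interchange)

  suc≤2* : ∀ {m} → 1 ≤ m → suc m ≤ 2 * m
  suc≤2* {m} 1≤m = +-mono-≤ 1≤m (≤-reflexive (≡.sym (+-identityʳ m)))

  m<2^m : ∀ m → m < 2 ^ m
  m<2^m zero    = s≤s z≤n
  m<2^m (suc m) = ≤-trans (s≤s (m<2^m m)) (suc≤2* (m^n>0 2 m))

  ^-cancelʳ-≤ : ∀ {m n} → 2 ^ m ≤ 2 ^ n → m ≤ n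
  ^-cancelʳ-≤ {m} {n} 2^m≤2^n with m ≤? n
  ... | yes m≤n = m≤n
  ... | no  m≰n = contradiction 2^m≤2^n (<⇒≱ (^-monoʳ-< 2 (s≤s (s≤s z≤n)) (≰⇒> m≰n)))

  -- The 2 ^ t monomials cost t + 2 ≤ 2 ^ (t + 1) edges each, which gives 2 ^ (2 t + 1). Three
  -- further doublings absorb the three successors in `depthFourSize`. The factor `E` beyond `E ^ r`
  -- comes from `L`.
  depthFourSize-bound : ∀ E r t T L → 1 ≤ E → T ≤ E ^ r → L ≤ E → depthFourSize T L t ≤ E ^ suc r * 2 ^ (2 * t + 4)
  depthFourSize-bound E@(suc _) r t T L _ T≤ L≤ = begin
    suc T * suc (L * suc (normalFormSize t))
      ≤⟨ *-mono-≤ (s≤s T≤) (s≤s (*-mono-≤ L≤ (≤-trans (s≤s normalForm≤) (suc≤2* (m^n>0 2 (t + suc t)))))) ⟩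
    suc (E ^ r) * suc (E * 2 ^ suc (t + suc t))
      ≤⟨ *-mono-≤ (suc≤2* (m^n>0 E r)) (suc≤2* (*-mono-≤ {1} {E} (s≤s z≤n) (m^n>0 2 (suc (t + suc t))))) ⟩
    2 * E ^ r * (2 * (E * 2 ^ suc (t + suc t)))
      ≡⟨ solve 3 (λ e x y → con 2 :* x :* (con 2 :* (e :* y)) := e :* x :* (con 2 :* (con 2 :* y))) refl E (E ^ r) (2 ^ suc (t + suc t)) ⟩
    E ^ suc r * 2 ^ suc (suc (suc (t + suc t)))
      ≡⟨ cong (λ x → E ^ suc r * 2 ^ x) (solve 1 (λ t → con 3 :+ (t :+ (con 1 :+ t)) := con 2 :* t :+ con 4) refl t) ⟩
    E ^ suc r * 2 ^ (2 * t + 4) ∎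
    where
    open +-*-Solver
    normalForm≤ : normalFormSize t ≤ 2 ^ (t + suc t)
    normalForm≤ = ≤-trans
      (*-monoʳ-≤ (2 ^ t) (≤-trans (s≤s (m<2^m t)) (suc≤2* (m^n>0 2 t))))
      (≤-reflexive (≡.sym (^-distribˡ-+-* 2 t (suc t))))

  m≤m^2 : ∀ m → m ≤ m ^ 2
  m≤m^2 zero      = z≤n
  m≤m^2 m@(suc _) = m≤m*n m (m * 1)

  -- `suc r` is the integer part of √d / A, found by descending from a value that is too large. The
  -- successor form records that it is positive, so that it can serve as a divisor.
  root : ∀ A d → .{{NonZero A}} → A ^ 2 ≤ d → ∃[ r ] (A * suc r) ^ 2 ≤ d × d < (A * suc (suc r)) ^ 2
  root A d A²≤d = search d (begin-strict
    d                        <⟨ ≤-trans (n<1+n d) (n≤1+n (suc d)) ⟩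
    suc (suc d)              ≡⟨ *-identityˡ (suc (suc d)) ⟨
    1 * suc (suc d)          ≤⟨ *-monoˡ-≤ (suc (suc d)) (>-nonZero⁻¹ A) ⟩
    A * suc (suc d)          ≤⟨ m≤m^2 (A * suc (suc d)) ⟩
    (A * suc (suc d)) ^ 2    ∎)
    where
    search : ∀ m → d < (A * suc (suc m)) ^ 2 → ∃[ r ] (A * suc r) ^ 2 ≤ d × d < (A * suc (suc r)) ^ 2
    search m d< with (A * suc m) ^ 2 ≤? d
    ... | yes ≤d = m , ≤d , d<
    search zero    d< | no ≰d = contradiction (≡.subst (λ x → x ^ 2 ≤ d) (≡.sym (*-identityʳ A)) A²≤d) ≰d
    search (suc m) d< | no ≰d = search m (≰⇒> ≰d)

  module _ (k q : ℕ) .{{_ : NonZero k}} .{{_ : NonZero q}} where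

    -- For R about √d / `stride`, the depth-four hypothesis applies at the exponent
    -- `stride * R / q`, which is 2 k R. Half of it pays for (n ^ k) ^ R and half for 2 ^ O(t). The
    -- factor `q` compensates for the denominator of c = p / q.
    stride : ℕ
    stride = 2 * k * q

    -- Makes (n ^ k) ^ R * 2 ^ (2 t + 4) < n ^ (2 k R) for R ≈ √d / (2 k q) and t ≈ n / R.
    growth : ℕ
    growth = suc (128 * k * q * q + stride ^ 2)

    record Parameters (n d : ℕ) : Set where
      field
        r t     : ℕ
        1≤t     : 1 ≤ t
        n≤      : n ≤ r * t + t
        root≤   : (stride * suc r) ^ 2 ≤ d
        depthFour<   : ∀ {T L} → T ≤ (n ^ k) ^ r → L ≤ n ^ k → depthFourSize T L t ^ q < n ^ (stride * suc r)

    private instance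
      stride≢0 : NonZero stride
      stride≢0 = m*n≢0 (2 * k) q {{m*n≢0 2 k}}

    parameters : ∀ n d → 1 ≤ n → d ≤ n → 2 ^ (growth * n) ≤ n ^ d → Parameters n d
    parameters n@(suc _) d 1≤n d≤n 2^≤n^d = record
      { r = r ; t = t ; 1≤t = s≤s z≤n ; n≤ = n≤ ; root≤ = root≤ ; depthFour< = depthFour< }
      where
      open +-*-Solver

      -- Since n < 2 ^ n, the growth condition already forces `d` to exceed any prescribed constant.
      -- The summand `stride ^ 2` of `growth` then provides a root that is at least 1.
      growth≤d : growth ≤ d
      growth≤d = *-cancelʳ-≤ growth d n (^-cancelʳ-≤ (begin
        2 ^ (growth * n)  ≤⟨ 2^≤n^d ⟩
        n ^ d             ≤⟨ ^-monoˡ-≤ d (<⇒≤ (m<2^m n)) ⟩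
        (2 ^ n) ^ d       ≡⟨ ^-*-assoc 2 n d ⟩
        2 ^ (n * d)       ≡⟨ cong (2 ^_) (*-comm n d) ⟩
        2 ^ (d * n)       ∎))

      theRoot : ∃[ r ] (stride * suc r) ^ 2 ≤ d × d < (stride * suc (suc r)) ^ 2
      theRoot = root stride d (≤-trans (≤-trans (m≤n+m (stride ^ 2) (128 * k * q * q)) (n≤1+n _)) growth≤d)

      r R t : ℕ
      r = proj₁ theRoot
      R = suc r
      -- Rounding up lets `R` blocks of `t` variables cover all n. The excess is at most `R ≤ n`, so
      -- `t * R` stays below 2 n.
      t = suc (n / R)

      root≤ : (stride * R) ^ 2 ≤ d
      root≤ = proj₁ (proj₂ theRoot)

      R≤n : R ≤ n
      R≤n = begin
        R                ≡⟨ *-identityˡ R ⟨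
        1 * R            ≤⟨ *-monoˡ-≤ R (>-nonZero⁻¹ stride) ⟩
        stride * R         ≤⟨ m≤m^2 (stride * R) ⟩
        (stride * R) ^ 2   ≤⟨ root≤ ⟩
        d                ≤⟨ d≤n ⟩
        n                ∎

      n≤ : n ≤ r * t + t
      n≤ = begin
        n                     ≡⟨ m≡m%n+[m/n]*n n R ⟩
        n % R + n / R * R     ≤⟨ +-monoˡ-≤ (n / R * R) (<⇒≤ (m%n<n n R)) ⟩
        R + n / R * R         ≡⟨ *-comm t R ⟩
        t + r * t             ≡⟨ +-comm t (r * t) ⟩
        r * t + t             ∎

      Rt≤ : t * R ≤ 2 * n
      Rt≤ = begin
        R + n / R * R  ≤⟨ +-mono-≤ R≤n (m/n*n≤m n R) ⟩
        n + n          ≡⟨ cong (n +_) (+-identityʳ n) ⟨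
        2 * n          ∎

      -- Half of `stride * R`. The upper estimate of the root becomes d ≤ (4 `half`) ^ 2: one factor
      -- 2 is that of `stride`, the other comes from R + 1 ≤ 2 R.
      half : ℕ
      half = k * q * R

      d≤square : d ≤ half * (16 * half)
      d≤square = begin
        d                              ≤⟨ <⇒≤ (proj₂ (proj₂ theRoot)) ⟩
        (stride * suc R) ^ 2             ≤⟨ ^-monoˡ-≤ 2 (*-monoʳ-≤ stride (suc≤2* {R} (s≤s z≤n))) ⟩
        (stride * (2 * R)) ^ 2
          ≡⟨ solve 3 (λ k q r → (con 2 :* k :* q :* (con 2 :* r)) :^ 2 :=
               (k :* q :* r) :* (con 16 :* (k :* q :* r))) refl k q R ⟩
        half * (16 * half)             ∎

      exponent≤ : (2 * t + 4) * q * (16 * half) ≤ 128 * k * q * q * n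
      exponent≤ = begin
        (2 * t + 4) * q * (16 * half)
          ≡⟨ solve 4 (λ k q r t → (con 2 :* t :+ con 4) :* q :* (con 16 :* (k :* q :* r)) :=
               con 16 :* k :* q :* q :* (con 2 :* (t :* r) :+ con 4 :* r)) refl k q R t ⟩
        16 * k * q * q * (2 * (t * R) + 4 * R)
          ≤⟨ *-monoʳ-≤ (16 * k * q * q) (+-mono-≤ (*-monoʳ-≤ 2 Rt≤) (*-monoʳ-≤ 4 R≤n)) ⟩
        16 * k * q * q * (2 * (2 * n) + 4 * n)
          ≡⟨ solve 3 (λ k q n → con 16 :* k :* q :* q :* (con 2 :* (con 2 :* n) :+ con 4 :* n) :=
               con 128 :* k :* q :* q :* n) refl k q n ⟩
        128 * k * q * q * n ∎

      -- This is where d = ω(n / log n) defeats the expansion cost. Otherwise, raising the reverse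
      -- inequality to the power 16 `half` and using d ≤ 16 `half` ^ 2 would give `growth * n` ≤ 128
      -- k q ^ 2 n, against the choice of `growth`.
      2^<n^half : 2 ^ ((2 * t + 4) * q) < n ^ half
      2^<n^half = ≰⇒> λ n^half≤ → <-irrefl refl (begin-strict
        128 * k * q * q * n  <⟨ *-monoˡ-< n {128 * k * q * q} {growth} (s≤s (m≤m+n (128 * k * q * q) (stride ^ 2))) ⟩
        growth * n           ≤⟨ ^-cancelʳ-≤ (begin
          2 ^ (growth * n)                      ≤⟨ 2^≤n^d ⟩
          n ^ d                                 ≤⟨ ^-monoʳ-≤ n d≤square ⟩
          n ^ (half * (16 * half))              ≡⟨ ^-*-assoc n half (16 * half) ⟨
          (n ^ half) ^ (16 * half)              ≤⟨ ^-monoˡ-≤ (16 * half) n^half≤ ⟩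
          (2 ^ ((2 * t + 4) * q)) ^ (16 * half) ≡⟨ ^-*-assoc 2 ((2 * t + 4) * q) (16 * half) ⟩
          2 ^ ((2 * t + 4) * q * (16 * half))   ∎) ⟩
        (2 * t + 4) * q * (16 * half)  ≤⟨ exponent≤ ⟩
        128 * k * q * q * n  ∎)

      depthFour< : ∀ {T L} → T ≤ (n ^ k) ^ r → L ≤ n ^ k → depthFourSize T L t ^ q < n ^ (stride * R)
      depthFour< {T} {L} T≤ L≤ = begin-strict
        depthFourSize T L t ^ q
          ≤⟨ ^-monoˡ-≤ q (depthFourSize-bound (n ^ k) r t T L (m^n>0 n k) T≤ L≤) ⟩
        ((n ^ k) ^ R * 2 ^ (2 * t + 4)) ^ q
          ≡⟨ ^-distribʳ-* ((n ^ k) ^ R) (2 ^ (2 * t + 4)) q ⟩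
        ((n ^ k) ^ R) ^ q * (2 ^ (2 * t + 4)) ^ q
          ≡⟨ cong₂ _*_ (≡.trans (cong (_^ q) (^-*-assoc n k R)) (^-*-assoc n (k * R) q)) (^-*-assoc 2 (2 * t + 4) q) ⟩
        n ^ (k * R * q) * 2 ^ ((2 * t + 4) * q)
          <⟨ *-monoʳ-< (n ^ (k * R * q)) {{m^n≢0 n (k * R * q)}} 2^<n^half ⟩
        n ^ (k * R * q) * n ^ half
          ≡⟨ ^-distribˡ-+-* n (k * R * q) half ⟨
        n ^ (k * R * q + half)
          ≡⟨ cong (n ^_) (solve 3 (λ k q r → k :* r :* q :+ k :* q :* r := con 2 :* k :* q :* r) refl k q R) ⟩
        n ^ (stride * R) ∎

module _ {c ℓ₁ ℓ₂} (F : HeytingField c ℓ₁ ℓ₂) where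

  private
    module K = CommutativeRing (HeytingCommutativeRing.commutativeRing (HeytingField.heytingCommutativeRing F))

    Poly : ℕ → Set c
    Poly = Polynomial F

    variable
      n k : ℕ

  open K using (Carrier; _≈_; 0#; 1#) renaming (_+_ to _+ᶠ_; _*_ to _*ᶠ_)

  infixl 6 _+ₚ_
  infixl 7 _*ₚ_

  _+ₚ_ _*ₚ_ : ∀ {n} → Poly n → Poly n → Poly n
  _+ₚ_ = _+ᴾ_ F
  _*ₚ_ = _*ᴾ_ F

  0ₚ 1ₚ : ∀ {n} → Poly n
  0ₚ = constᴾ F 0#
  1ₚ = constᴾ F 1#

  -- The semiring of polynomials, through linear functionals

  module _ where
    open CommutativeSemigroupProperties K.+-commutativeSemigroup using (interchange)
    open SetoidReasoning K.setoid

    -- The linear extension of φ from monomials to formal sums. Testing against all φ turns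
    -- identities between unordered, unreduced lists into identities in the field.
    lin : ∀ {n} → (Monomial n → Carrier) → Poly n → Carrier
    lin φ []            = 0#
    lin φ ((a , e) ∷ f) = a *ᶠ φ e +ᶠ lin φ f

    lin-cong : ∀ {n} {φ ψ : Monomial n → Carrier} → (∀ e → φ e ≈ ψ e) → ∀ f → lin φ f ≈ lin ψ f
    lin-cong φ≈ψ []            = K.refl
    lin-cong φ≈ψ ((a , e) ∷ f) = K.+-cong (K.*-congˡ (φ≈ψ e)) (lin-cong φ≈ψ f)

    lin-++ : ∀ {n} (φ : Monomial n → Carrier) f g → lin φ (f ++ g) ≈ lin φ f +ᶠ lin φ g
    lin-++ φ []            g = K.sym (K.+-identityˡ _)
    lin-++ φ ((a , e) ∷ f) g = begin
      a *ᶠ φ e +ᶠ lin φ (f ++ g)        ≈⟨ K.+-congˡ (lin-++ φ f g) ⟩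
      a *ᶠ φ e +ᶠ (lin φ f +ᶠ lin φ g)  ≈⟨ K.+-assoc _ _ _ ⟨
      a *ᶠ φ e +ᶠ lin φ f +ᶠ lin φ g    ∎

    lin-zero : ∀ {n} (f : Poly n) → lin (λ _ → 0#) f ≈ 0#
    lin-zero []            = K.refl
    lin-zero ((a , e) ∷ f) = begin
      a *ᶠ 0# +ᶠ lin (λ _ → 0#) f  ≈⟨ K.+-cong (K.zeroʳ a) (lin-zero f) ⟩
      0# +ᶠ 0#                     ≈⟨ K.+-identityˡ 0# ⟩
      0#                           ∎

    lin-+ : ∀ {n} (φ ψ : Monomial n → Carrier) f → lin (λ e → φ e +ᶠ ψ e) f ≈ lin φ f +ᶠ lin ψ f
    lin-+ φ ψ []            = K.sym (K.+-identityˡ 0#)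
    lin-+ φ ψ ((a , e) ∷ f) = begin
      a *ᶠ (φ e +ᶠ ψ e) +ᶠ lin (λ e → φ e +ᶠ ψ e) f   ≈⟨ K.+-cong (K.distribˡ a _ _) (lin-+ φ ψ f) ⟩
      (a *ᶠ φ e +ᶠ a *ᶠ ψ e) +ᶠ (lin φ f +ᶠ lin ψ f)  ≈⟨ interchange _ _ _ _ ⟩
      (a *ᶠ φ e +ᶠ lin φ f) +ᶠ (a *ᶠ ψ e +ᶠ lin ψ f)  ∎

    lin-* : ∀ {n} b (φ : Monomial n → Carrier) f → lin (λ e → b *ᶠ φ e) f ≈ b *ᶠ lin φ f
    lin-* b φ []            = K.sym (K.zeroʳ b)
    lin-* b φ ((a , e) ∷ f) = begin
      a *ᶠ (b *ᶠ φ e) +ᶠ lin (λ e → b *ᶠ φ e) f  ≈⟨ K.+-cong (x∙yz≈y∙xz a b (φ e)) (lin-* b φ f) ⟩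
      b *ᶠ (a *ᶠ φ e) +ᶠ b *ᶠ lin φ f            ≈⟨ K.distribˡ b _ _ ⟨
      b *ᶠ (a *ᶠ φ e +ᶠ lin φ f)                 ∎
      where open CommutativeSemigroupProperties K.*-commutativeSemigroup using (x∙yz≈y∙xz)

    lin-swap : ∀ {m n} (φ : Monomial m → Monomial n → Carrier) f g →
      lin (λ e → lin (φ e) g) f ≈ lin (λ e′ → lin (λ e → φ e e′) f) g
    lin-swap φ []            g = K.sym (lin-zero g)
    lin-swap φ ((a , e) ∷ f) g = begin
      a *ᶠ lin (φ e) g +ᶠ lin (λ e → lin (φ e) g) f
        ≈⟨ K.+-cong (K.sym (lin-* a (φ e) g)) (lin-swap φ f g) ⟩
      lin (λ e′ → a *ᶠ φ e e′) g +ᶠ lin (λ e′ → lin (λ e → φ e e′) f) g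
        ≈⟨ lin-+ _ _ g ⟨
      lin (λ e′ → a *ᶠ φ e e′ +ᶠ lin (λ e → φ e e′) f) g ∎

    -- A functional of a product is a double sum over pairs of monomials. The laws of multiplication
    -- thereby reduce to those of adding exponents, with `lin-swap` exchanging the two sums for
    -- commutativity.
    lin-*ₚ : ∀ {n} (φ : Monomial n → Carrier) f g →
      lin φ (f *ₚ g) ≈ lin (λ e → lin (λ e′ → φ (zipWith _+_ e e′)) g) f
    lin-*ₚ φ []            g = K.refl
    lin-*ₚ φ ((a , e) ∷ f) g = K.trans (lin-++ φ (map _ g) (f *ₚ g)) (K.+-cong (term g) (lin-*ₚ φ f g))
      where
      term : ∀ g → lin φ (map (λ (b , e′) → a *ᶠ b , zipWith _+_ e e′) g) ≈
                   a *ᶠ lin (λ e′ → φ (zipWith _+_ e e′)) g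
      term []             = K.sym (K.zeroʳ a)
      term ((b , e′) ∷ g) = begin
        a *ᶠ b *ᶠ φ (zipWith _+_ e e′) +ᶠ lin φ (map _ g)  ≈⟨ K.+-cong (K.*-assoc a b _) (term g) ⟩
        a *ᶠ (b *ᶠ φ (zipWith _+_ e e′)) +ᶠ a *ᶠ lin _ g   ≈⟨ K.distribˡ a _ _ ⟨
        a *ᶠ (b *ᶠ φ (zipWith _+_ e e′) +ᶠ lin _ g)        ∎

    lin-constᴾ : ∀ {n} (φ : Monomial n → Carrier) a → lin φ (constᴾ F a) ≈ a *ᶠ φ (replicate n 0)
    lin-constᴾ φ a = K.+-identityʳ _

    lin-constᴾ-* : ∀ {n} (φ : Monomial n → Carrier) a f → lin φ (constᴾ F a *ₚ f) ≈ a *ᶠ lin φ f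
    lin-constᴾ-* φ a f = begin
      lin φ (constᴾ F a *ₚ f)                                     ≈⟨ lin-*ₚ φ (constᴾ F a) f ⟩
      a *ᶠ lin (λ e → φ (zipWith _+_ (replicate _ 0) e)) f +ᶠ 0#  ≈⟨ K.+-identityʳ _ ⟩
      a *ᶠ lin (λ e → φ (zipWith _+_ (replicate _ 0) e)) f
        ≈⟨ K.*-congˡ (lin-cong (λ e → K.reflexive (cong φ (Vecₚ.zipWith-identityˡ ℕₚ.+-identityˡ e))) f) ⟩
      a *ᶠ lin φ f                                              ∎

    δ : ∀ {n} → Monomial n → Monomial n → Carrier
    δ m e = if does (Vecₚ.≡-dec _≟_ e m) then 1# else 0#

    coeff≈lin : ∀ {n} (f : Poly n) m → coeff F f m ≈ lin (δ m) f
    coeff≈lin []            m = K.refl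
    coeff≈lin ((a , e) ∷ f) m with does (Vecₚ.≡-dec _≟_ e m)
    ... | true  = K.+-cong (K.sym (K.*-identityʳ a)) (coeff≈lin f m)
    ... | false = begin
      coeff F f m             ≈⟨ coeff≈lin f m ⟩
      lin (δ m) f             ≈⟨ K.+-identityˡ _ ⟨
      0# +ᶠ lin (δ m) f       ≈⟨ K.+-congʳ (K.zeroʳ a) ⟨
      a *ᶠ 0# +ᶠ lin (δ m) f  ∎

    -- Equality of all linear functionals coincides with equality of coefficients, and
    -- makes the congruence of multiplication immediate.
    infix 4 _≈ₚ_
    record _≈ₚ_ {n} (f g : Poly n) : Set (c ⊔ ℓ₁) where
      constructor ext
      field lin≈ : ∀ φ → lin φ f ≈ lin φ g
    open _≈ₚ_ public

    ≈ₚ⇒≈ᴾ : ∀ {n} {f g : Poly n} → f ≈ₚ g → _≈ᴾ_ F f g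
    ≈ₚ⇒≈ᴾ {f = f} {g} f≈g m = begin
      coeff F f m  ≈⟨ coeff≈lin f m ⟩
      lin (δ m) f  ≈⟨ lin≈ f≈g (δ m) ⟩
      lin (δ m) g  ≈⟨ coeff≈lin g m ⟨
      coeff F g m  ∎

    polynomialSemiring : ℕ → CommutativeSemiring c (c ⊔ ℓ₁)
    polynomialSemiring n = record
      { Carrier = Poly n
      ; _≈_ = _≈ₚ_
      ; _+_ = _+ₚ_
      ; _*_ = _*ₚ_
      ; 0# = 0ₚ
      ; 1# = 1ₚ
      ; isCommutativeSemiring = isCommutativeSemiringˡ record
        { +-isCommutativeMonoid = isCommutativeMonoidˡ record
          { isSemigroup = record
            { isMagma = record
              { isEquivalence = isEquivalence
              ; ∙-cong = λ {f} {f′} {g} {g′} f≈f′ g≈g′ → ext λ φ → begin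
                  lin φ (f ++ g)        ≈⟨ lin-++ φ f g ⟩
                  lin φ f +ᶠ lin φ g    ≈⟨ K.+-cong (lin≈ f≈f′ φ) (lin≈ g≈g′ φ) ⟩
                  lin φ f′ +ᶠ lin φ g′  ≈⟨ lin-++ φ f′ g′ ⟨
                  lin φ (f′ ++ g′)      ∎ }
            ; assoc = λ f g h → ext λ φ → begin
                lin φ ((f ++ g) ++ h)            ≈⟨ K.trans (lin-++ φ (f ++ g) h) (K.+-congʳ (lin-++ φ f g)) ⟩
                (lin φ f +ᶠ lin φ g) +ᶠ lin φ h  ≈⟨ K.+-assoc _ _ _ ⟩
                lin φ f +ᶠ (lin φ g +ᶠ lin φ h)  ≈⟨ K.trans (lin-++ φ f (g ++ h)) (K.+-congˡ (lin-++ φ g h)) ⟨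
                lin φ (f ++ (g ++ h))            ∎ }
          ; identityˡ = λ f → ext λ φ → begin
              0# *ᶠ φ _ +ᶠ lin φ f  ≈⟨ K.+-congʳ (K.zeroˡ _) ⟩
              0# +ᶠ lin φ f         ≈⟨ K.+-identityˡ _ ⟩
              lin φ f               ∎
          ; comm = λ f g → ext λ φ → begin
              lin φ (f ++ g)      ≈⟨ lin-++ φ f g ⟩
              lin φ f +ᶠ lin φ g  ≈⟨ K.+-comm _ _ ⟩
              lin φ g +ᶠ lin φ f  ≈⟨ lin-++ φ g f ⟨
              lin φ (g ++ f)      ∎ }
        ; *-isCommutativeMonoid = isCommutativeMonoidˡ record
          { isSemigroup = record
            { isMagma = record
              { isEquivalence = isEquivalence
              ; ∙-cong = λ {f} {f′} {g} {g′} f≈f′ g≈g′ → ext λ φ → begin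
                  lin φ (f *ₚ g)            ≈⟨ lin-*ₚ φ f g ⟩
                  lin (λ e → lin _ g) f     ≈⟨ lin-cong (λ e → lin≈ g≈g′ _) f ⟩
                  lin (λ e → lin _ g′) f    ≈⟨ lin≈ f≈f′ _ ⟩
                  lin (λ e → lin _ g′) f′   ≈⟨ lin-*ₚ φ f′ g′ ⟨
                  lin φ (f′ *ₚ g′)          ∎ }
            ; assoc = λ f g h → ext λ φ → begin
                lin φ ((f *ₚ g) *ₚ h)
                  ≈⟨ K.trans (lin-*ₚ φ (f *ₚ g) h) (lin-*ₚ _ f g) ⟩
                lin (λ e → lin (λ e′ → lin (λ e″ → φ (zipWith _+_ (zipWith _+_ e e′) e″)) h) g) f
                  ≈⟨ lin-cong (λ e → lin-cong (λ e′ → lin-cong (λ e″ →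
                       K.reflexive (cong φ (Vecₚ.zipWith-assoc ℕₚ.+-assoc e e′ e″))) h) g) f ⟩
                lin (λ e → lin (λ e′ → lin (λ e″ → φ (zipWith _+_ e (zipWith _+_ e′ e″))) h) g) f
                  ≈⟨ K.trans (lin-*ₚ φ f (g *ₚ h)) (lin-cong (λ e → lin-*ₚ _ g h) f) ⟨
                lin φ (f *ₚ (g *ₚ h)) ∎ }
          ; identityˡ = λ f → ext λ φ → begin
              lin φ (1ₚ *ₚ f)  ≈⟨ lin-constᴾ-* φ 1# f ⟩
              1# *ᶠ lin φ f    ≈⟨ K.*-identityˡ _ ⟩
              lin φ f          ∎
          ; comm = λ f g → ext λ φ → begin
              lin φ (f *ₚ g)                                        ≈⟨ lin-*ₚ φ f g ⟩
              lin (λ e → lin (λ e′ → φ (zipWith _+_ e e′)) g) f   ≈⟨ lin-swap _ f g ⟩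
              lin (λ e′ → lin (λ e → φ (zipWith _+_ e e′)) f) g
                ≈⟨ lin-cong (λ e′ → lin-cong (λ e → K.reflexive (cong φ (Vecₚ.zipWith-comm ℕₚ.+-comm e e′))) f) g ⟩
              lin (λ e′ → lin (λ e → φ (zipWith _+_ e′ e)) f) g   ≈⟨ lin-*ₚ φ g f ⟨
              lin φ (g *ₚ f)                                        ∎ }
        ; distribʳ = λ h f g → ext λ φ → begin
            lin φ ((f ++ g) *ₚ h)                ≈⟨ K.trans (lin-*ₚ φ (f ++ g) h) (lin-++ _ f g) ⟩
            lin (λ e → lin _ h) f +ᶠ lin (λ e → lin _ h) g
              ≈⟨ K.trans (lin-++ φ (f *ₚ h) (g *ₚ h)) (K.+-cong (lin-*ₚ φ f h) (lin-*ₚ φ g h)) ⟨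
            lin φ (f *ₚ h ++ g *ₚ h)             ∎
        ; zeroˡ = λ f → ext λ φ → begin
            lin φ (0ₚ *ₚ f)  ≈⟨ K.trans (lin-constᴾ-* φ 0# f) (K.zeroˡ _) ⟩
            0#               ≈⟨ K.trans (lin-constᴾ φ 0#) (K.zeroˡ _) ⟨
            lin φ 0ₚ         ∎ } }
      where
      isEquivalence : IsEquivalence (_≈ₚ_ {n})
      isEquivalence = record
        { refl = ext λ φ → K.refl
        ; sym = λ f≈g → ext λ φ → K.sym (lin≈ f≈g φ)
        ; trans = λ f≈g g≈h → ext λ φ → K.trans (lin≈ f≈g φ) (lin≈ g≈h φ) }

  module Pₚ {n} = CommutativeSemiring (polynomialSemiring n)

  -- Variable sets and supports

  ∈-⋃⁻ : ∀ {i : Fin n} ps → i ∈ ⋃ ps → Any (i ∈_) ps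
  ∈-⋃⁻ []       i∈ = contradiction i∈ Subsetₚ.∉⊥
  ∈-⋃⁻ (p ∷ ps) i∈ = [ here , there ∘ ∈-⋃⁻ ps ]′ (Subsetₚ.x∈p∪q⁻ p (⋃ ps) i∈)

  ∈-⋃⁺ : ∀ {i : Fin n} {ps} → Any (i ∈_) ps → i ∈ ⋃ ps
  ∈-⋃⁺ (here i∈)  = Subsetₚ.x∈p∪q⁺ (inj₁ i∈)
  ∈-⋃⁺ (there i∈) = Subsetₚ.x∈p∪q⁺ (inj₂ (∈-⋃⁺ i∈))

  disjoint⁺ : ∀ {p q : Subset n} → (∀ {i} → i ∈ p → i ∉ q) → Disjoint p q
  disjoint⁺ {p = p} {q} f (i , i∈) = let i∈p , i∈q = Subsetₚ.x∈p∩q⁻ p q i∈ in f i∈p i∈q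

  disjoint⁻ : ∀ {p q : Subset n} → Disjoint p q → ∀ {i} → i ∈ p → i ∉ q
  disjoint⁻ p∩q≡∅ {i} i∈p i∈q = p∩q≡∅ (i , Subsetₚ.x∈p∩q⁺ (i∈p , i∈q))

  disjoint-mono : ∀ {p p′ q q′ : Subset n} → p ⊆ p′ → q ⊆ q′ → Disjoint p′ q′ → Disjoint p q
  disjoint-mono p⊆p′ q⊆q′ d = disjoint⁺ λ i∈p i∈q → disjoint⁻ d (p⊆p′ i∈p) (q⊆q′ i∈q)

  disjoint-⋃ : ∀ {p : Subset n} {qs} → All (Disjoint p) qs → Disjoint p (⋃ qs)
  disjoint-⋃ ds = disjoint⁺ λ i∈p i∈⋃ →
    let d , i∈q = All.lookupAny ds (∈-⋃⁻ _ i∈⋃) in disjoint⁻ d i∈p i∈q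

  Within : Subset n → Monomial n → Set
  Within S e = ∀ i → lookup e i ≡ 0 ⊎ lookup e i ≡ 1 × i ∈ S

  -- Carries multilinearity as well as the variable set, since `Within` allows only the exponents 0
  -- and 1. It constrains every listed term, whatever its coefficient, so no test for zero is
  -- involved.
  Supported : Subset n → Poly n → Set c
  Supported S = All (Within S ∘ proj₂)

  within-mono : ∀ {S S′ : Subset n} {e} → S ⊆ S′ → Within S e → Within S′ e
  within-mono S⊆S′ w i = [ inj₁ , inj₂ ∘ map₂ S⊆S′ ]′ (w i)

  supported-mono : ∀ {S S′ : Subset n} {f} → S ⊆ S′ → Supported S f → Supported S′ f
  supported-mono S⊆S′ = All.map (λ {t} → within-mono {e = proj₂ t} S⊆S′)

  within-+ : ∀ {S S′ : Subset n} {e e′} → Disjoint S S′ → Within S e → Within S′ e′ →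
    Within (S ∪ S′) (zipWith _+_ e e′)
  within-+ {e = e} {e′} d w w′ i rewrite Vecₚ.lookup-zipWith _+_ i e e′ with w i | w′ i
  ... | inj₁ ≡0         | inj₁ ≡0′          rewrite ≡0 | ≡0′ = inj₁ refl
  ... | inj₁ ≡0         | inj₂ (≡1′ , i∈S′) rewrite ≡0 | ≡1′ = inj₂ (refl , Subsetₚ.x∈p∪q⁺ (inj₂ i∈S′))
  ... | inj₂ (≡1 , i∈S) | inj₁ ≡0′          rewrite ≡1 | ≡0′ = inj₂ (refl , Subsetₚ.x∈p∪q⁺ (inj₁ i∈S))
  ... | inj₂ (_  , i∈S) | inj₂ (_  , i∈S′)  = contradiction i∈S′ (disjoint⁻ d i∈S)

  within-0 : ∀ (S : Subset n) → Within S (replicate n 0)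
  within-0 S i = inj₁ (Vecₚ.lookup-replicate i 0)

  supported-constᴾ : ∀ (S : Subset n) a → Supported S (constᴾ F a)
  supported-constᴾ S a = within-0 S ∷ []

  within-unit : ∀ i → Within ⁅ i ⁆ (replicate n 0 [ i ]≔ 1)
  within-unit zero    zero    = inj₂ (refl , here)
  within-unit zero    (suc j) = inj₁ (Vecₚ.lookup-replicate j 0)
  within-unit (suc i) zero    = inj₁ refl
  within-unit (suc i) (suc j) = [ inj₁ , inj₂ ∘ map₂ there ]′ (within-unit i j)

  supported-*ₚ : ∀ {S S′ : Subset n} → Disjoint S S′ → ∀ {f g} → Supported S f → Supported S′ g →
    Supported (S ∪ S′) (f *ₚ g)
  supported-*ₚ d []       sg = []
  supported-*ₚ d {f = (_ , e) ∷ _} (w ∷ sf) sg =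
    Allₚ.++⁺ (Allₚ.map⁺ (All.map (λ {t} → within-+ {e = e} {proj₂ t} d w) sg)) (supported-*ₚ d sf sg)

  supported-Σ : ∀ {S : Subset n} {fs} → All (Supported S) fs → Supported S (foldr _+ₚ_ 0ₚ fs)
  supported-Σ []         = supported-constᴾ _ 0#
  supported-Σ (sf ∷ sfs) = Allₚ.++⁺ sf (supported-Σ sfs)

  supported-Π : ∀ {a} {A : Set a} {X : A → Subset n} {P : A → Poly n} → (∀ u → Supported (X u) (P u)) →
    ∀ us → AllPairs Disjoint (map X us) → Supported (⋃ (map X us)) (foldr _*ₚ_ 1ₚ (map P us))
  supported-Π sP []       _        = supported-constᴾ _ 1#
  supported-Π sP (u ∷ us) (d ∷ ds) = supported-*ₚ (disjoint-⋃ d) (sP u) (supported-Π sP us ds)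

  -- Only a product gate could create an exponent 2, and there syntactic multilinearity makes the
  -- variable sets of the factors disjoint.
  polynomialAt-supported : ∀ {k} (G : Graph F n k) → SyntacticallyMultilinearᴳ F G →
    ∀ v → Supported (variablesAt F G v) (polynomialAt F G v)
  polynomialAt-supported (var i     ∷ G) sm       zero    = within-unit i ∷ []
  polynomialAt-supported (const a   ∷ G) sm       zero    = supported-constᴾ _ a
  polynomialAt-supported (gate ⊕ us ∷ G) sm       zero    =
    supported-Σ (Allₚ.map⁺ {xs = toList us} (All.tabulate λ {u} u∈us → supported-mono
      (λ i∈ → ∈-⋃⁺ (Anyₚ.map⁺ (Any.map (λ where refl → i∈) u∈us)))
      (polynomialAt-supported G sm u)))
  polynomialAt-supported (gate ⊗ us ∷ G) (ds , sm) zero   =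
    supported-Π (polynomialAt-supported G sm) (toList us) ds
  polynomialAt-supported (var _     ∷ G) sm       (suc v) = polynomialAt-supported G sm v
  polynomialAt-supported (const _   ∷ G) sm       (suc v) = polynomialAt-supported G sm v
  polynomialAt-supported (gate ⊕ _  ∷ G) sm       (suc v) = polynomialAt-supported G sm v
  polynomialAt-supported (gate ⊗ _  ∷ G) (_ , sm) (suc v) = polynomialAt-supported G sm v

  -- Normal form of a polynomial supported on few variables

  subsets : Subset n → List (Subset n)
  subsets []            = [] ∷ []
  subsets (outside ∷ S) = map (outside ∷_) (subsets S)
  subsets (inside  ∷ S) = map (outside ∷_) (subsets S) ++ map (inside ∷_) (subsets S)

  length-subsets : ∀ (S : Subset n) → length (subsets S) ≡ 2 ^ ∣ S ∣
  length-subsets []            = refl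
  length-subsets (outside ∷ S) = ≡.trans (Listₚ.length-map _ (subsets S)) (length-subsets S)
  length-subsets (inside  ∷ S) = ≡.trans (Listₚ.length-++ (map (outside ∷_) (subsets S)))
    (cong₂ _+_ (≡.trans (Listₚ.length-map _ (subsets S)) (length-subsets S))
                 (≡.trans (Listₚ.length-map _ (subsets S))
                          (≡.trans (length-subsets S) (≡.sym (ℕₚ.+-identityʳ _)))))

  subsets-⊆ : ∀ (S : Subset n) → All (_⊆ S) (subsets S)
  subsets-⊆ []            = Subsetₚ.⊆-refl ∷ []
  subsets-⊆ (outside ∷ S) = Allₚ.map⁺ (All.map {P = _⊆ S} Subsetₚ.out⊆ (subsets-⊆ S))
  subsets-⊆ (inside  ∷ S) = Allₚ.++⁺
    (Allₚ.map⁺ (All.map {P = _⊆ S} Subsetₚ.out⊆ (subsets-⊆ S)))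
    (Allₚ.map⁺ (All.map {P = _⊆ S} Subsetₚ.in⊆in (subsets-⊆ S)))

  elements : Subset n → List (Fin n)
  elements []            = []
  elements (outside ∷ S) = map suc (elements S)
  elements (inside  ∷ S) = zero ∷ map suc (elements S)

  length-elements : ∀ (S : Subset n) → length (elements S) ≡ ∣ S ∣
  length-elements []            = refl
  length-elements (outside ∷ S) = ≡.trans (Listₚ.length-map suc (elements S)) (length-elements S)
  length-elements (inside  ∷ S) = cong suc (≡.trans (Listₚ.length-map suc (elements S)) (length-elements S))

  elements-∈ : ∀ (S : Subset n) → All (_∈ S) (elements S)
  elements-∈ []            = []
  elements-∈ (outside ∷ S) = Allₚ.map⁺ (All.map there (elements-∈ S))
  elements-∈ (inside  ∷ S) = here ∷ Allₚ.map⁺ (All.map there (elements-∈ S))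

  elements-distinct : ∀ (S : Subset n) → AllPairs _≢_ (elements S)
  elements-distinct []            = []
  elements-distinct (outside ∷ S) =
    AllPairsₚ.map⁺ (AllPairs.map (λ i≢j → λ where refl → i≢j refl) (elements-distinct S))
  elements-distinct (inside  ∷ S) =
    Allₚ.map⁺ (All.universal (λ _ ()) _) ∷
    AllPairsₚ.map⁺ (AllPairs.map (λ i≢j → λ where refl → i≢j refl) (elements-distinct S))

  indicator : Subset n → Monomial n
  indicator = Vec.map (if_then 1 else 0)

  monomialᴾ : Carrier → Subset n → Poly n
  monomialᴾ a T = foldr _*ₚ_ 1ₚ (constᴾ F a ∷ map (varᴾ F) (elements T))

  -- Subsets with coefficient zero are kept, so the cost depends on the number of variables alone.
  normalForm : Subset n → Poly n → Poly n
  normalForm S g = foldr _+ₚ_ 0ₚ (map (λ T → monomialᴾ (coeff F g (indicator T)) T) (subsets S))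

  module _ where
    open CommutativeSemigroupProperties K.+-commutativeSemigroup using (interchange)
    open SetoidReasoning K.setoid

    private
      sumUnits : List (Fin n) → Monomial n
      sumUnits = foldr (λ i → zipWith _+_ (replicate _ 0 [ i ]≔ 1)) (replicate _ 0)

      sumUnits-suc : ∀ (is : List (Fin n)) → sumUnits (map suc is) ≡ 0 ∷ sumUnits is
      sumUnits-suc []       = refl
      sumUnits-suc (i ∷ is) rewrite sumUnits-suc is = refl

      sumUnits-elements : ∀ (T : Subset n) → sumUnits (elements T) ≡ indicator T
      sumUnits-elements []            = refl
      sumUnits-elements (outside ∷ T) = ≡.trans (sumUnits-suc (elements T)) (cong (0 ∷_) (sumUnits-elements T))
      sumUnits-elements (inside  ∷ T) rewrite sumUnits-suc (elements T) =
        cong (1 ∷_) (≡.trans (Vecₚ.zipWith-identityˡ ℕₚ.+-identityˡ _) (sumUnits-elements T))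

      lin-vars : ∀ (φ : Monomial n → Carrier) is →
        lin φ (foldr _*ₚ_ 1ₚ (map (varᴾ F) is)) ≈ φ (sumUnits is)
      lin-vars φ []       = K.trans (K.+-identityʳ _) (K.*-identityˡ _)
      lin-vars φ (i ∷ is) = begin
        lin φ (varᴾ F i *ₚ vars)  ≈⟨ lin-*ₚ φ (varᴾ F i) vars ⟩
        1# *ᶠ lin φ′ vars +ᶠ 0#   ≈⟨ K.trans (K.+-identityʳ _) (K.*-identityˡ _) ⟩
        lin φ′ vars               ≈⟨ lin-vars φ′ is ⟩
        φ (sumUnits (i ∷ is))     ∎
        where
        vars = foldr _*ₚ_ 1ₚ (map (varᴾ F) is)
        φ′ = φ ∘ zipWith _+_ (replicate _ 0 [ i ]≔ 1)

    lin-monomialᴾ : ∀ (φ : Monomial n → Carrier) a T → lin φ (monomialᴾ a T) ≈ a *ᶠ φ (indicator T)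
    lin-monomialᴾ φ a T = begin
      lin φ (monomialᴾ a T)                                   ≈⟨ lin-constᴾ-* φ a (foldr _*ₚ_ 1ₚ (map (varᴾ F) (elements T))) ⟩
      a *ᶠ lin φ (foldr _*ₚ_ 1ₚ (map (varᴾ F) (elements T)))  ≈⟨ K.*-congˡ (lin-vars φ (elements T)) ⟩
      a *ᶠ φ (sumUnits (elements T))                          ≡⟨ cong (λ e → a *ᶠ φ e) (sumUnits-elements T) ⟩
      a *ᶠ φ (indicator T)                                    ∎

    ∑ : ∀ {a} {A : Set a} → List A → (A → Carrier) → Carrier
    ∑ []       h = 0#
    ∑ (x ∷ xs) h = h x +ᶠ ∑ xs h

    module _ {a} {A : Set a} where

      ∑-cong : ∀ {h h′ : A → Carrier} → (∀ x → h x ≈ h′ x) → ∀ xs → ∑ xs h ≈ ∑ xs h′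
      ∑-cong h≈h′ []       = K.refl
      ∑-cong h≈h′ (x ∷ xs) = K.+-cong (h≈h′ x) (∑-cong h≈h′ xs)

      ∑-zero : ∀ {h : A → Carrier} → (∀ x → h x ≈ 0#) → ∀ xs → ∑ xs h ≈ 0#
      ∑-zero h≈0 []       = K.refl
      ∑-zero h≈0 (x ∷ xs) = K.trans (K.+-cong (h≈0 x) (∑-zero h≈0 xs)) (K.+-identityˡ 0#)

      ∑-+ : ∀ (h h′ : A → Carrier) xs → ∑ xs (λ x → h x +ᶠ h′ x) ≈ ∑ xs h +ᶠ ∑ xs h′
      ∑-+ h h′ []       = K.sym (K.+-identityˡ 0#)
      ∑-+ h h′ (x ∷ xs) = K.trans (K.+-congˡ (∑-+ h h′ xs)) (interchange _ _ _ _)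

      ∑-* : ∀ b (h : A → Carrier) xs → ∑ xs (λ x → b *ᶠ h x) ≈ b *ᶠ ∑ xs h
      ∑-* b h []       = K.sym (K.zeroʳ b)
      ∑-* b h (x ∷ xs) = K.trans (K.+-congˡ (∑-* b h xs)) (K.sym (K.distribˡ b _ _))

      ∑-++ : ∀ (h : A → Carrier) xs ys → ∑ (xs ++ ys) h ≈ ∑ xs h +ᶠ ∑ ys h
      ∑-++ h []       ys = K.sym (K.+-identityˡ _)
      ∑-++ h (x ∷ xs) ys = K.trans (K.+-congˡ (∑-++ h xs ys)) (K.sym (K.+-assoc _ _ _))

      ∑-map : ∀ {b} {B : Set b} (h : A → Carrier) (g : B → A) xs → ∑ (map g xs) h ≡ ∑ xs (h ∘ g)
      ∑-map h g []       = refl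
      ∑-map h g (x ∷ xs) = cong (h (g x) +ᶠ_) (∑-map h g xs)

      lin-Σ : ∀ (φ : Monomial n → Carrier) (P : A → Poly n) xs →
        lin φ (foldr _+ₚ_ 0ₚ (map P xs)) ≈ ∑ xs (λ x → lin φ (P x))
      lin-Σ φ P []       = K.trans (lin-constᴾ φ 0#) (K.zeroˡ _)
      lin-Σ φ P (x ∷ xs) = K.trans (lin-++ φ (P x) _) (K.+-congˡ (lin-Σ φ P xs))

    -- Only the subset with indicator e contributes, and `Within S e` guarantees that it is listed.
    -- At each variable of S the exponent in e decides which half of the list survives.
    ∑-subsets : ∀ {S : Subset n} {e} (h : Monomial n → Carrier) →
      (∀ m → e ≢ m → h m ≈ 0#) → Within S e → ∑ (subsets S) (h ∘ indicator) ≈ h e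
    ∑-subsets {S = []} {[]} h h≈0 w = K.+-identityʳ _
    ∑-subsets {S = outside ∷ S} {x ∷ e} h h≈0 w with w zero
    ... | inj₁ refl = begin
      ∑ (map (outside ∷_) (subsets S)) (h ∘ indicator) ≡⟨ ∑-map (h ∘ indicator) (outside ∷_) (subsets S) ⟩
      ∑ (subsets S) (h ∘ (0 ∷_) ∘ indicator)
        ≈⟨ ∑-subsets (h ∘ (0 ∷_)) (λ m e≢m → h≈0 (0 ∷ m) (e≢m ∘ Vecₚ.∷-injectiveʳ))
             (λ i → [ inj₁ , inj₂ ∘ map₂ Subsetₚ.drop-there ]′ (w (suc i))) ⟩
      h (0 ∷ e) ∎
    ... | inj₂ (_ , ())
    ∑-subsets {S = inside ∷ S} {x ∷ e} h h≈0 w = begin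
      ∑ (map (outside ∷_) (subsets S) ++ map (inside ∷_) (subsets S)) (h ∘ indicator)
        ≈⟨ ∑-++ _ (map (outside ∷_) (subsets S)) _ ⟩
      ∑ (map (outside ∷_) (subsets S)) (h ∘ indicator) +ᶠ ∑ (map (inside ∷_) (subsets S)) (h ∘ indicator)
        ≡⟨ cong₂ _+ᶠ_ (∑-map (h ∘ indicator) (outside ∷_) (subsets S)) (∑-map (h ∘ indicator) (inside ∷_) (subsets S)) ⟩
      ∑ (subsets S) (h ∘ (0 ∷_) ∘ indicator) +ᶠ ∑ (subsets S) (h ∘ (1 ∷_) ∘ indicator)
        ≈⟨ byHead (w zero) ⟩
      h (x ∷ e) ∎
      where
      tails : ∀ y → (∀ m → e ≢ m → h (y ∷ m) ≈ 0#) → ∑ (subsets S) (h ∘ (y ∷_) ∘ indicator) ≈ h (y ∷ e)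
      tails y h≈0′ = ∑-subsets (h ∘ (y ∷_)) h≈0′
        (λ i → [ inj₁ , inj₂ ∘ map₂ Subsetₚ.drop-there ]′ (w (suc i)))

      byHead : (x ≡ 0 ⊎ x ≡ 1 × zero ∈ inside ∷ S) →
        ∑ (subsets S) (h ∘ (0 ∷_) ∘ indicator) +ᶠ ∑ (subsets S) (h ∘ (1 ∷_) ∘ indicator) ≈ h (x ∷ e)
      byHead (inj₁ refl) = K.trans
        (K.+-cong (tails 0 λ m e≢m → h≈0 _ (e≢m ∘ Vecₚ.∷-injectiveʳ)) (∑-zero (λ T → h≈0 _ λ ()) (subsets S)))
        (K.+-identityʳ _)
      byHead (inj₂ (refl , _)) = K.trans
        (K.+-cong (∑-zero (λ T → h≈0 _ λ ()) (subsets S)) (tails 1 λ m e≢m → h≈0 _ (e≢m ∘ Vecₚ.∷-injectiveʳ)))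
        (K.+-identityˡ _)

    -- Induction over the terms of g: a term with monomial e is picked up by exactly one subset,
    -- through `δ`.
    ≈-normalForm : ∀ {S : Subset n} {g} → Supported S g → g ≈ₚ normalForm S g
    ≈-normalForm {n} {S} {g} sg = ext λ φ → K.sym (begin
      lin φ (normalForm S g)
        ≈⟨ lin-Σ φ _ (subsets S) ⟩
      ∑ (subsets S) (λ T → lin φ (monomialᴾ (coeff F g (indicator T)) T))
        ≈⟨ ∑-cong (λ T → K.trans (lin-monomialᴾ φ _ T) (K.*-congʳ (coeff≈lin g (indicator T)))) (subsets S) ⟩
      ∑ (subsets S) (λ T → lin (δ (indicator T)) g *ᶠ φ (indicator T))
        ≈⟨ collect φ sg ⟩
      lin φ g ∎)
      where
      δ*φ : (Monomial n → Carrier) → Monomial n → Monomial n → Carrier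
      δ*φ φ e m = δ m e *ᶠ φ m

      δ*φ-≢ : ∀ φ {e} m → e ≢ m → δ*φ φ e m ≈ 0#
      δ*φ-≢ φ {e} m e≢m rewrite dec-false (Vecₚ.≡-dec _≟_ e m) e≢m = K.zeroˡ _

      δ*φ-≡ : ∀ φ e → δ*φ φ e e ≈ φ e
      δ*φ-≡ φ e rewrite dec-true (Vecₚ.≡-dec _≟_ e e) refl = K.*-identityˡ _

      collect : ∀ φ {g} → Supported S g →
        ∑ (subsets S) (λ T → lin (δ (indicator T)) g *ᶠ φ (indicator T)) ≈ lin φ g
      collect φ {[]}          []       = ∑-zero (λ T → K.zeroˡ _) (subsets S)
      collect φ {(a , e) ∷ g} (w ∷ sg) = begin
        ∑ (subsets S) (λ T → (a *ᶠ δ (indicator T) e +ᶠ lin (δ (indicator T)) g) *ᶠ φ (indicator T))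
          ≈⟨ ∑-cong (λ T → K.trans (K.distribʳ _ _ _) (K.+-congʳ (K.*-assoc a _ _))) (subsets S) ⟩
        ∑ (subsets S) (λ T → a *ᶠ δ*φ φ e (indicator T) +ᶠ lin (δ (indicator T)) g *ᶠ φ (indicator T))
          ≈⟨ K.trans (∑-+ _ _ (subsets S)) (K.+-congʳ (∑-* a _ (subsets S))) ⟩
        a *ᶠ ∑ (subsets S) (δ*φ φ e ∘ indicator) +ᶠ ∑ (subsets S) (λ T → lin (δ (indicator T)) g *ᶠ φ (indicator T))
          ≈⟨ K.+-cong (K.*-congˡ (K.trans (∑-subsets (δ*φ φ e) (δ*φ-≢ φ) w) (δ*φ-≡ φ e))) (collect φ sg) ⟩
        a *ᶠ φ e +ᶠ lin φ g ∎

  module _ {a p} {A : Set a} {P : Pred A p} (P? : Decidable P) where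

    -- Keeping everything when nothing satisfies P leaves the gates not above w intact.
    restrict : List⁺ A → List⁺ A
    restrict us = fromMaybe us (List⁺.fromList (filter P? (toList us)))

    restrict-any : ∀ us → Any P (toList us) → toList (restrict us) ≡ filter P? (toList us)
    restrict-any us any with filter P? (toList us) | Listₚ.filter-some P? any
    ... | _ ∷ _ | _ = refl

    restrict-none : ∀ us → ¬ Any P (toList us) → restrict us ≡ us
    restrict-none us none rewrite Listₚ.filter-none P? (Allₚ.¬Any⇒All¬ _ none) = refl

    restrict-⊆ : ∀ us {q} {Q : Pred A q} → Any Q (toList (restrict us)) → Any Q (toList us)
    restrict-⊆ us Q∈ with Any.any? P? (toList us)
    ... | yes any  rewrite restrict-any us any = Anyₚ.filter⁻ P? Q∈
    ... | no  none rewrite restrict-none us none = Q∈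

    restrict-all : ∀ us → Any P (toList us) → All P (toList (restrict us))
    restrict-all us any = ≡.subst (All P) (≡.sym (restrict-any us any)) (Allₚ.all-filter P? (toList us))

    length-restrict : ∀ us → List⁺.length (restrict us) ≤ List⁺.length us
    length-restrict us with Any.any? P? (toList us)
    ... | no  none = ℕₚ.≤-reflexive (cong List⁺.length (restrict-none us none))
    ... | yes any  = ℕₚ.≤-trans (ℕₚ.≤-reflexive (cong length (restrict-any us any)))
                                (Listₚ.length-filter P? (toList us))

  -- Surgery at a vertex w of a circuit

  -- Reachability of w from v, reflexive at w.
  Above : Graph F n k → Fin k → Fin k → Set
  Above (_         ∷ G) (suc w) (suc v) = Above G w v
  Above (_         ∷ G) zero    zero    = ⊤
  Above (_         ∷ G) zero    (suc _) = ⊥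
  Above (var _     ∷ G) (suc w) zero    = ⊥
  Above (const _   ∷ G) (suc w) zero    = ⊥
  Above (gate _ us ∷ G) (suc w) zero    = Any (Above G w) (toList us)

  above? : (G : Graph F n k) (w : Fin k) → Decidable (Above G w)
  above? (_         ∷ G) (suc w) (suc v) = above? G w v
  above? (_         ∷ G) zero    zero    = yes tt
  above? (_         ∷ G) zero    (suc _) = no λ ()
  above? (var _     ∷ G) (suc w) zero    = no λ ()
  above? (const _   ∷ G) (suc w) zero    = no λ ()
  above? (gate _ us ∷ G) (suc w) zero    = Any.any? (above? G w) (toList us)

  -- Putting a constant in place of w preserves all indices and the edges into w; exactly the edges
  -- leaving w are lost.
  erase : Graph F n k → Fin k → Graph F n k
  erase (N ∷ G) zero    = const 0# ∷ G
  erase (N ∷ G) (suc w) = N ∷ erase G w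

  -- Product gates need no change: by multilinearity at most one factor lies above w.
  quotientNode : Graph F n k → Fin k → Node F n k → Node F n k
  quotientNode G w (gate ⊕ us) = gate ⊕ (restrict (above? G w) us)
  quotientNode G w N           = N

  -- A vertex above w computes in the quotient the coefficient of w, as if w were a variable.
  quotient : Graph F n k → Fin k → Graph F n k
  quotient (N ∷ G) zero    = const 1# ∷ G
  quotient (N ∷ G) (suc w) = quotientNode G w N ∷ quotient G w

  fanIn : Node F n k → ℕ
  fanIn (var _)     = 0
  fanIn (const _)   = 0
  fanIn (gate _ us) = List⁺.length us

  fanInAt : Graph F n k → Fin k → ℕ
  fanInAt (N ∷ G) zero    = fanIn N
  fanInAt (N ∷ G) (suc w) = fanInAt G w

  edges-∷ : ∀ (N : Node F n k) G → edges F (N ∷ G) ≡ fanIn N + edges F G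
  edges-∷ (var _)    G = refl
  edges-∷ (const _)  G = refl
  edges-∷ (gate _ _) G = refl

  edges-erase : ∀ (G : Graph F n k) w → fanInAt G w + edges F (erase G w) ≡ edges F G
  edges-erase (N ∷ G) zero    = ≡.sym (edges-∷ N G)
  edges-erase (N ∷ G) (suc w) = begin
    fanInAt G w + edges F (N ∷ erase G w)            ≡⟨ cong (fanInAt G w +_) (edges-∷ N (erase G w)) ⟩
    fanInAt G w + (fanIn N + edges F (erase G w))  ≡⟨ x∙yz≈y∙xz (fanInAt G w) (fanIn N) _ ⟩
    fanIn N + (fanInAt G w + edges F (erase G w))  ≡⟨ cong (fanIn N +_) (edges-erase G w) ⟩
    fanIn N + edges F G                              ≡⟨ edges-∷ N G ⟨
    edges F (N ∷ G)                                    ∎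
    where
    open ≡.≡-Reasoning
    open CommutativeSemigroupProperties ℕₚ.+-commutativeSemigroup using (x∙yz≈y∙xz)

  fanIn-quotientNode : ∀ (G : Graph F n k) w N → fanIn (quotientNode G w N) ≤ fanIn N
  fanIn-quotientNode G w (var _)     = ℕₚ.≤-refl
  fanIn-quotientNode G w (const _)   = ℕₚ.≤-refl
  fanIn-quotientNode G w (gate ⊕ us) = length-restrict (above? G w) us
  fanIn-quotientNode G w (gate ⊗ us) = ℕₚ.≤-refl

  -- Both surgeries put a constant at w, and the restriction of sums can only drop further edges.
  -- Hence D, like Z, saves the full fan-in of w.
  edges-quotient : ∀ (G : Graph F n k) w → edges F (quotient G w) ≤ edges F (erase G w)
  edges-quotient (N ∷ G) zero    = ℕₚ.≤-refl
  edges-quotient (N ∷ G) (suc w)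
    rewrite edges-∷ (quotientNode G w N) (quotient G w) | edges-∷ N (erase G w) =
    ℕₚ.+-mono-≤ (fanIn-quotientNode G w N) (edges-quotient G w)

  sm-tail : ∀ (N : Node F n k) {G} → SyntacticallyMultilinearᴳ F (N ∷ G) → SyntacticallyMultilinearᴳ F G
  sm-tail (var _)    sm       = sm
  sm-tail (const _)  sm       = sm
  sm-tail (gate ⊕ _) sm       = sm
  sm-tail (gate ⊗ _) (_ , sm) = sm

  ⋃-map-mono : ∀ {a} {A : Set a} {X Y : A → Subset n} → (∀ u → X u ⊆ Y u) →
    ∀ us → ⋃ (map X us) ⊆ ⋃ (map Y us)
  ⋃-map-mono X⊆Y us i∈ = ∈-⋃⁺ (Anyₚ.map⁺ (Any.map (λ {u} → X⊆Y u) (Anyₚ.map⁻ (∈-⋃⁻ (map _ us) i∈))))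

  pairwise-disjoint-mono : ∀ {a} {A : Set a} {X Y : A → Subset n} → (∀ u → X u ⊆ Y u) →
    ∀ us → AllPairs Disjoint (map Y us) → AllPairs Disjoint (map X us)
  pairwise-disjoint-mono X⊆Y us ds = AllPairsₚ.map⁺ (AllPairs.map
    (λ {u} {v} → disjoint-mono (X⊆Y u) (X⊆Y v)) (AllPairsₚ.map⁻ ds))

  erase-variables : ∀ (G : Graph F n k) w v → variablesAt F (erase G w) v ⊆ variablesAt F G v
  erase-variables (N         ∷ G) zero    zero    i∈ = contradiction i∈ Subsetₚ.∉⊥
  erase-variables (N         ∷ G) zero    (suc v) i∈ = i∈
  erase-variables (N         ∷ G) (suc w) (suc v) i∈ = erase-variables G w v i∈
  erase-variables (var _     ∷ G) (suc w) zero    i∈ = i∈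
  erase-variables (const _   ∷ G) (suc w) zero    i∈ = i∈
  erase-variables (gate _ us ∷ G) (suc w) zero    i∈ = ⋃-map-mono (erase-variables G w) (toList us) i∈

  erase-sm : ∀ (G : Graph F n k) w → SyntacticallyMultilinearᴳ F G → SyntacticallyMultilinearᴳ F (erase G w)
  erase-sm (N         ∷ G) zero    sm        = sm-tail N sm
  erase-sm (var _     ∷ G) (suc w) sm        = erase-sm G w sm
  erase-sm (const _   ∷ G) (suc w) sm        = erase-sm G w sm
  erase-sm (gate ⊕ _  ∷ G) (suc w) sm        = erase-sm G w sm
  erase-sm (gate ⊗ us ∷ G) (suc w) (ds , sm) =
    pairwise-disjoint-mono (erase-variables G w) (toList us) ds , erase-sm G w sm

  erase-¬above : ∀ (G : Graph F n k) w v → ¬ Above G w v → polynomialAt F (erase G w) v ≡ polynomialAt F G v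
  erase-¬above (N         ∷ G) zero    zero    ¬a = contradiction tt ¬a
  erase-¬above (N         ∷ G) zero    (suc v) ¬a = refl
  erase-¬above (N         ∷ G) (suc w) (suc v) ¬a = erase-¬above G w v ¬a
  erase-¬above (var _     ∷ G) (suc w) zero    ¬a = refl
  erase-¬above (const _   ∷ G) (suc w) zero    ¬a = refl
  erase-¬above (gate ⊕ us ∷ G) (suc w) zero    ¬a = cong (foldr _+ₚ_ 0ₚ)
    (Listₚ.map-cong-local (All.map (λ {u} → erase-¬above G w u) (Allₚ.¬Any⇒All¬ (toList us) ¬a)))
  erase-¬above (gate ⊗ us ∷ G) (suc w) zero    ¬a = cong (foldr _*ₚ_ 1ₚ)
    (Listₚ.map-cong-local (All.map (λ {u} → erase-¬above G w u) (Allₚ.¬Any⇒All¬ (toList us) ¬a)))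

  quotient-variables : ∀ (G : Graph F n k) w v → variablesAt F (quotient G w) v ⊆ variablesAt F G v
  quotient-variables (N         ∷ G) zero    zero    i∈ = contradiction i∈ Subsetₚ.∉⊥
  quotient-variables (N         ∷ G) zero    (suc v) i∈ = i∈
  quotient-variables (N         ∷ G) (suc w) (suc v) i∈ = quotient-variables G w v i∈
  quotient-variables (var _     ∷ G) (suc w) zero    i∈ = i∈
  quotient-variables (const _   ∷ G) (suc w) zero    i∈ = i∈
  quotient-variables (gate ⊕ us ∷ G) (suc w) zero    i∈ =
    ∈-⋃⁺ (Anyₚ.map⁺ (restrict-⊆ (above? G w) us (Anyₚ.map⁻ (∈-⋃⁻ _
      (⋃-map-mono (quotient-variables G w) (toList (restrict (above? G w) us)) i∈)))))
  quotient-variables (gate ⊗ us ∷ G) (suc w) zero    i∈ = ⋃-map-mono (quotient-variables G w) (toList us) i∈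

  quotient-sm : ∀ (G : Graph F n k) w → SyntacticallyMultilinearᴳ F G → SyntacticallyMultilinearᴳ F (quotient G w)
  quotient-sm (N         ∷ G) zero    sm        = sm-tail N sm
  quotient-sm (var _     ∷ G) (suc w) sm        = quotient-sm G w sm
  quotient-sm (const _   ∷ G) (suc w) sm        = quotient-sm G w sm
  quotient-sm (gate ⊕ _  ∷ G) (suc w) sm        = quotient-sm G w sm
  quotient-sm (gate ⊗ us ∷ G) (suc w) (ds , sm) =
    pairwise-disjoint-mono (quotient-variables G w) (toList us) ds , quotient-sm G w sm

  quotient-¬above : ∀ (G : Graph F n k) w v → ¬ Above G w v →
    polynomialAt F (quotient G w) v ≡ polynomialAt F G v
  quotient-¬above (N         ∷ G) zero    zero    ¬a = contradiction tt ¬a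
  quotient-¬above (N         ∷ G) zero    (suc v) ¬a = refl
  quotient-¬above (N         ∷ G) (suc w) (suc v) ¬a = quotient-¬above G w v ¬a
  quotient-¬above (var _     ∷ G) (suc w) zero    ¬a = refl
  quotient-¬above (const _   ∷ G) (suc w) zero    ¬a = refl
  quotient-¬above (gate ⊕ us ∷ G) (suc w) zero    ¬a rewrite restrict-none (above? G w) us ¬a = cong (foldr _+ₚ_ 0ₚ)
    (Listₚ.map-cong-local (All.map (λ {u} → quotient-¬above G w u) (Allₚ.¬Any⇒All¬ (toList us) ¬a)))
  quotient-¬above (gate ⊗ us ∷ G) (suc w) zero    ¬a = cong (foldr _*ₚ_ 1ₚ)
    (Listₚ.map-cong-local (All.map (λ {u} → quotient-¬above G w u) (Allₚ.¬Any⇒All¬ (toList us) ¬a)))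

  above-variables : ∀ (G : Graph F n k) w v → Above G w v → variablesAt F G w ⊆ variablesAt F G v
  above-variables (N         ∷ G) zero    zero    a i∈ = i∈
  above-variables (N         ∷ G) (suc w) (suc v) a i∈ = above-variables G w v a i∈
  above-variables (gate _ us ∷ G) (suc w) zero    a i∈ =
    ∈-⋃⁺ (Anyₚ.map⁺ (Any.map (λ {u} au → above-variables G w u au i∈) a))

  -- At a sum only children above w are kept. At a product the factor above w contains all variables
  -- of w, so its siblings avoid them by multilinearity, and that factor itself is handled by
  -- induction.
  quotient-disjoint : ∀ (G : Graph F n k) w v → SyntacticallyMultilinearᴳ F G → Above G w v →
    Disjoint (variablesAt F (quotient G w) v) (variablesAt F G w)
  quotient-disjoint (N ∷ G) zero    zero    sm a = disjoint⁺ λ i∈ _ → contradiction i∈ Subsetₚ.∉⊥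
  quotient-disjoint (N ∷ G) (suc w) (suc v) sm a = quotient-disjoint G w v (sm-tail N sm) a
  quotient-disjoint (gate ⊕ us ∷ G) (suc w) zero sm a =
    disjoint⁺ λ i∈ i∈w → let au , i∈u = All.lookupAny (restrict-all (above? G w) us a) (Anyₚ.map⁻ (∈-⋃⁻ _ i∈)) in
      disjoint⁻ (quotient-disjoint G w _ sm au) i∈u i∈w
  quotient-disjoint (gate ⊗ us ∷ G) (suc w) zero (ds , sm) a =
    disjoint⁺ λ i∈ i∈w → impossible i∈w (toList us) ds a (Anyₚ.map⁻ (∈-⋃⁻ _ i∈))
    where
    X = variablesAt F G
    X′ = variablesAt F (quotient G w)

    impossible : ∀ {i} → i ∈ X w → ∀ us → AllPairs Disjoint (map X us) → Any (Above G w) us → ¬ Any (λ u → i ∈ X′ u) us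
    impossible i∈w (u ∷ us) (d ∷ ds) (here au)  (here i∈u) = disjoint⁻ (quotient-disjoint G w u sm au) i∈u i∈w
    impossible i∈w (u ∷ us) (d ∷ ds) (here au)  (there i∈us) =
      let d′ , i∈ = All.lookupAny (Allₚ.map⁻ d) i∈us in
      disjoint⁻ d′ (above-variables G w u au i∈w) (quotient-variables G w _ i∈)
    impossible i∈w (u ∷ us) (d ∷ ds) (there aus) (here i∈u) =
      let d′ , a = All.lookupAny (Allₚ.map⁻ d) aus in
      disjoint⁻ d′ (quotient-variables G w u i∈u) (above-variables G w _ a i∈w)
    impossible i∈w (u ∷ us) (d ∷ ds) (there aus) (there i∈us) = impossible i∈w us ds aus i∈us

  module _ {a p} {A : Set a} {Q : Pred A p} (Q? : Decidable Q) {P Z D : A → Poly n} {W : Poly n}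
    (P-above : ∀ u → Q u → P u ≈ₚ Z u +ₚ D u *ₚ W) (Z-¬above : ∀ u → ¬ Q u → Z u ≡ P u) where

    open SetoidReasoning (Pₚ.setoid {n})
    open CommutativeSemigroupProperties (Pₚ.+-commutativeSemigroup {n}) using (interchange)

    private
      Σ Π : List (Poly n) → Poly n
      Σ = foldr _+ₚ_ 0ₚ
      Π = foldr _*ₚ_ 1ₚ

    -- `P`, `Z`, `D` are the polynomials of the children in the graph, the erased graph and the
    -- quotient, and `W` is that of w. A summand not above w belongs entirely to the part free of w,
    -- hence the filter on `D`.
    Σ-quotient : ∀ us → Σ (map P us) ≈ₚ Σ (map Z us) +ₚ Σ (map D (filter Q? us)) *ₚ W
    Σ-quotient []       = Pₚ.sym (Pₚ.trans (Pₚ.+-congˡ {x = 0ₚ} (Pₚ.zeroˡ W)) (Pₚ.+-identityʳ 0ₚ))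
    Σ-quotient (u ∷ us) with Q? u
    ... | yes q = begin
      P u +ₚ Σ (map P us)
        ≈⟨ Pₚ.+-cong (P-above u q) (Σ-quotient us) ⟩
      (Z u +ₚ D u *ₚ W) +ₚ (Σ (map Z us) +ₚ Σ (map D (filter Q? us)) *ₚ W)
        ≈⟨ interchange (Z u) (D u *ₚ W) (Σ (map Z us)) (Σ (map D (filter Q? us)) *ₚ W) ⟩
      (Z u +ₚ Σ (map Z us)) +ₚ (D u *ₚ W +ₚ Σ (map D (filter Q? us)) *ₚ W)
        ≈⟨ Pₚ.+-congˡ (Pₚ.distribʳ W (D u) (Σ (map D (filter Q? us)))) ⟨
      (Z u +ₚ Σ (map Z us)) +ₚ (D u +ₚ Σ (map D (filter Q? us))) *ₚ W ∎
    ... | no ¬q = begin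
      P u +ₚ Σ (map P us)
        ≈⟨ Pₚ.+-cong (Pₚ.reflexive (≡.sym (Z-¬above u ¬q))) (Σ-quotient us) ⟩
      Z u +ₚ (Σ (map Z us) +ₚ Σ (map D (filter Q? us)) *ₚ W)
        ≈⟨ Pₚ.+-assoc (Z u) (Σ (map Z us)) (Σ (map D (filter Q? us)) *ₚ W) ⟨
      (Z u +ₚ Σ (map Z us)) +ₚ Σ (map D (filter Q? us)) *ₚ W ∎

    module _ (D-¬above : ∀ u → ¬ Q u → D u ≡ P u) where

      -- With exactly one factor above w the product is linear in `W`. All other factors are common
      -- to `Z` and `D` and can be pulled out.
      Π-quotient : ∀ us → AllPairs (λ u v → Q u → ¬ Q v) us → Any Q us →
        Π (map P us) ≈ₚ Π (map Z us) +ₚ Π (map D us) *ₚ W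
      Π-quotient (u ∷ us) (one ∷ ones) any with Q? u
      ... | yes q = begin
        P u *ₚ Π (map P us)
          ≈⟨ Pₚ.*-congʳ (P-above u q) ⟩
        (Z u +ₚ D u *ₚ W) *ₚ Π (map P us)
          ≈⟨ Pₚ.distribʳ (Π (map P us)) (Z u) (D u *ₚ W) ⟩
        Z u *ₚ Π (map P us) +ₚ (D u *ₚ W) *ₚ Π (map P us)
          ≈⟨ Pₚ.+-congˡ {x = Z u *ₚ Π (map P us)} (xy∙z≈xz∙y (D u) W (Π (map P us))) ⟩
        Z u *ₚ Π (map P us) +ₚ (D u *ₚ Π (map P us)) *ₚ W
          ≡⟨ cong₂ (λ z d → Z u *ₚ Π z +ₚ (D u *ₚ Π d) *ₚ W) (rest Z-¬above) (rest D-¬above) ⟨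
        Z u *ₚ Π (map Z us) +ₚ (D u *ₚ Π (map D us)) *ₚ W ∎
        where
        open CommutativeSemigroupProperties (Pₚ.*-commutativeSemigroup {n}) using (xy∙z≈xz∙y)
        rest : ∀ {Y : A → Poly n} → (∀ u → ¬ Q u → Y u ≡ P u) → map Y us ≡ map P us
        rest Y≡P = Listₚ.map-cong-local (All.map (λ {v} ¬q → Y≡P v (¬q q)) one)
      ... | no ¬q = begin
        P u *ₚ Π (map P us)
          ≈⟨ Pₚ.*-congˡ {x = P u} (Π-quotient us ones (Any.tail ¬q any)) ⟩
        P u *ₚ (Π (map Z us) +ₚ Π (map D us) *ₚ W)
          ≈⟨ Pₚ.distribˡ (P u) (Π (map Z us)) (Π (map D us) *ₚ W) ⟩
        P u *ₚ Π (map Z us) +ₚ P u *ₚ (Π (map D us) *ₚ W)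
          ≈⟨ Pₚ.+-congˡ {x = P u *ₚ Π (map Z us)} (Pₚ.*-assoc (P u) (Π (map D us)) W) ⟨
        P u *ₚ Π (map Z us) +ₚ (P u *ₚ Π (map D us)) *ₚ W
          ≡⟨ cong₂ (λ z d → z *ₚ Π (map Z us) +ₚ (d *ₚ Π (map D us)) *ₚ W) (Z-¬above u ¬q) (D-¬above u ¬q) ⟨
        Z u *ₚ Π (map Z us) +ₚ (D u *ₚ Π (map D us)) *ₚ W ∎

  -- A variable of w is what forbids two factors of a product above w. For a constant w disjointness
  -- would say nothing, and powers of its polynomial could appear.
  quotient-above : ∀ (G : Graph F n k) w v → SyntacticallyMultilinearᴳ F G → Nonempty (variablesAt F G w) →
    Above G w v →
    polynomialAt F G v ≈ₚ polynomialAt F (erase G w) v +ₚ polynomialAt F (quotient G w) v *ₚ polynomialAt F G w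
  quotient-above (N ∷ G) zero zero sm X≢∅ a = Pₚ.sym (Pₚ.trans
    (Pₚ.+-identityˡ (1ₚ *ₚ polynomialAt F (N ∷ G) zero)) (Pₚ.*-identityˡ (polynomialAt F (N ∷ G) zero)))
  quotient-above (N ∷ G) (suc w) (suc v) sm X≢∅ a = quotient-above G w v (sm-tail N sm) X≢∅ a
  quotient-above (gate ⊕ us ∷ G) (suc w) zero sm X≢∅ a = Pₚ.trans
    (Σ-quotient (above? G w) (λ u → quotient-above G w u sm X≢∅) (erase-¬above G w) (toList us))
    (Pₚ.reflexive (cong (λ us′ → polynomialAt F (erase (gate ⊕ us ∷ G) (suc w)) zero +ₚ
        foldr _+ₚ_ 0ₚ (map (polynomialAt F (quotient G w)) us′) *ₚ polynomialAt F G w)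
      (≡.sym (restrict-any (above? G w) us a))))
  quotient-above (gate ⊗ us ∷ G) (suc w) zero (ds , sm) X≢∅@(i , i∈w) a =
    Π-quotient (above? G w) (λ u → quotient-above G w u sm X≢∅) (erase-¬above G w) (quotient-¬above G w)
      (toList us) (AllPairs.map
        (λ {u} {v} d au av → disjoint⁻ d (above-variables G w u au i∈w) (above-variables G w v av i∈w)) (AllPairsₚ.map⁻ ds)) a

  -- Decomposition into products of polynomials in few variables

  disjoint-∣∪∣ : ∀ (p q : Subset n) → Disjoint p q → ∣ p ∣ + ∣ q ∣ ≤ ∣ p ∪ q ∣
  disjoint-∣∪∣ []            []            d = z≤n
  disjoint-∣∪∣ (outside ∷ p) (outside ∷ q) d = disjoint-∣∪∣ p q (Subsetₚ.drop-∷-Empty d)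
  disjoint-∣∪∣ (inside  ∷ p) (outside ∷ q) d = s≤s (disjoint-∣∪∣ p q (Subsetₚ.drop-∷-Empty d))
  disjoint-∣∪∣ (outside ∷ p) (inside  ∷ q) d rewrite ℕₚ.+-suc ∣ p ∣ ∣ q ∣ =
    s≤s (disjoint-∣∪∣ p q (Subsetₚ.drop-∷-Empty d))
  disjoint-∣∪∣ (inside  ∷ p) (inside  ∷ q) d = contradiction (zero , here) d

  0<∣p∣⇒nonempty : ∀ (p : Subset n) → 0 < ∣ p ∣ → Nonempty p
  0<∣p∣⇒nonempty {n} p 0<∣p∣ with Subsetₚ.nonempty? p
  ... | yes p≢∅ = p≢∅
  ... | no  p≡∅ rewrite Subsetₚ.Empty-unique p≡∅ | Subsetₚ.∣⊥∣≡0 n = contradiction 0<∣p∣ λ ()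

  module _ {n : ℕ} (t : ℕ) where

    Factor : Set c
    Factor = Subset n × Poly n

    IsSmall : Factor → Set c
    IsSmall (S , g) = ∣ S ∣ ≤ t × Supported S g

    Inside : Subset n → Factor → Set
    Inside X (S , _) = S ⊆ X

    -- `inside-X` lets terms over disjoint sets be concatenated without losing disjointness of the
    -- factors, which in turn makes the product gate built from a term syntactically multilinear.
    record IsTerm (X : Subset n) (L : ℕ) (τ : List Factor) : Set c where
      field
        small    : All IsSmall τ
        disjoint : AllPairs (Disjoint on proj₁) τ
        inside-X : All (Inside X) τ
        short    : length τ ≤ L
    open IsTerm public

    value : List Factor → Poly n
    value τ = foldr _*ₚ_ 1ₚ (map proj₂ τ)

    total : List (List Factor) → Poly n
    total τs = foldr _+ₚ_ 0ₚ (map value τs)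

    record Decomposition (X : Subset n) (N L : ℕ) (p : Poly n) : Set (c ⊔ ℓ₁) where
      field
        terms   : List (List Factor)
        isTerm  : All (IsTerm X L) terms
        few     : length terms ≤ N
        correct : p ≈ₚ total terms
    open Decomposition public

    module _ where
      open SetoidReasoning (Pₚ.setoid {n})

      value-++ : ∀ σ τ → value (σ ++ τ) ≈ₚ value σ *ₚ value τ
      value-++ []            τ = Pₚ.sym (Pₚ.*-identityˡ (value τ))
      value-++ ((S , g) ∷ σ) τ = begin
        g *ₚ value (σ ++ τ)          ≈⟨ Pₚ.*-congˡ {x = g} (value-++ σ τ) ⟩
        g *ₚ (value σ *ₚ value τ)    ≈⟨ Pₚ.*-assoc g (value σ) (value τ) ⟨
        g *ₚ value σ *ₚ value τ      ∎

      total-++ : ∀ σs τs → total (σs ++ τs) ≈ₚ total σs +ₚ total τs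
      total-++ []       τs = Pₚ.sym (Pₚ.+-identityˡ (total τs))
      total-++ (σ ∷ σs) τs = begin
        value σ +ₚ total (σs ++ τs)          ≈⟨ Pₚ.+-congˡ {x = value σ} (total-++ σs τs) ⟩
        value σ +ₚ (total σs +ₚ total τs)    ≈⟨ Pₚ.+-assoc (value σ) (total σs) (total τs) ⟨
        value σ +ₚ total σs +ₚ total τs      ∎

      total-map-++ : ∀ σ τs → total (map (σ ++_) τs) ≈ₚ value σ *ₚ total τs
      total-map-++ σ []       = Pₚ.sym (Pₚ.zeroʳ (value σ))
      total-map-++ σ (τ ∷ τs) = begin
        value (σ ++ τ) +ₚ total (map (σ ++_) τs)       ≈⟨ Pₚ.+-cong (value-++ σ τ) (total-map-++ σ τs) ⟩
        value σ *ₚ value τ +ₚ value σ *ₚ total τs      ≈⟨ Pₚ.distribˡ (value σ) (value τ) (total τs) ⟨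
        value σ *ₚ (value τ +ₚ total τs)               ∎

      total-product : ∀ σs τs → total (cartesianProductWith _++_ σs τs) ≈ₚ total σs *ₚ total τs
      total-product []       τs = Pₚ.sym (Pₚ.zeroˡ (total τs))
      total-product (σ ∷ σs) τs = begin
        total (map (σ ++_) τs ++ cartesianProductWith _++_ σs τs)
          ≈⟨ total-++ (map (σ ++_) τs) (cartesianProductWith _++_ σs τs) ⟩
        total (map (σ ++_) τs) +ₚ total (cartesianProductWith _++_ σs τs)
          ≈⟨ Pₚ.+-cong (total-map-++ σ τs) (total-product σs τs) ⟩
        value σ *ₚ total τs +ₚ total σs *ₚ total τs
          ≈⟨ Pₚ.distribʳ (total τs) (value σ) (total σs) ⟨
        (value σ +ₚ total σs) *ₚ total τs ∎

    length-product : ∀ (σs τs : List (List Factor)) →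
      length (cartesianProductWith _++_ σs τs) ≡ length σs * length τs
    length-product []       τs = refl
    length-product (σ ∷ σs) τs = ≡.trans (Listₚ.length-++ (map (σ ++_) τs))
      (cong₂ _+_ (Listₚ.length-map (σ ++_) τs) (length-product σs τs))

    isTerm-mono : ∀ {X Y L M τ} → X ⊆ Y → L ≤ M → IsTerm X L τ → IsTerm Y M τ
    isTerm-mono {X} {Y} X⊆Y L≤M τ-ok = record
      { small    = small τ-ok
      ; disjoint = disjoint τ-ok
      ; inside-X = All.map {P = Inside X} {Q = Inside Y} (λ S⊆X i∈ → X⊆Y (S⊆X i∈)) (inside-X τ-ok)
      ; short    = ℕₚ.≤-trans (short τ-ok) L≤M }

    isTerm-++ : ∀ {X Y L M σ τ} → Disjoint X Y → IsTerm X L σ → IsTerm Y M τ → IsTerm (X ∪ Y) (L + M) (σ ++ τ)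
    isTerm-++ {X} {Y} {σ = σ} d σ-ok τ-ok = record
      { small    = Allₚ.++⁺ (small σ-ok) (small τ-ok)
      ; disjoint = AllPairsₚ.++⁺ (disjoint σ-ok) (disjoint τ-ok)
          (All.map {P = Inside X} (λ S⊆X → All.map {P = Inside Y} (λ T⊆Y → disjoint-mono S⊆X T⊆Y d) (inside-X τ-ok)) (inside-X σ-ok))
      ; inside-X = Allₚ.++⁺
          (inside-X (isTerm-mono (Subsetₚ.p⊆p∪q Y) ℕₚ.≤-refl σ-ok))
          (inside-X (isTerm-mono (Subsetₚ.q⊆p∪q X Y) ℕₚ.≤-refl τ-ok))
      ; short    = ℕₚ.≤-trans (ℕₚ.≤-reflexive (Listₚ.length-++ σ)) (ℕₚ.+-mono-≤ (short σ-ok) (short τ-ok)) }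

    weaken : ∀ {X Y N N′ L L′ p q} → X ⊆ Y → N ≤ N′ → L ≤ L′ → q ≈ₚ p →
      Decomposition X N L p → Decomposition Y N′ L′ q
    weaken X⊆Y N≤N′ L≤L′ q≈p D = record
      { terms   = terms D
      ; isTerm  = All.map (isTerm-mono X⊆Y L≤L′) (isTerm D)
      ; few     = ℕₚ.≤-trans (few D) N≤N′
      ; correct = Pₚ.trans q≈p (correct D) }

    sum : ∀ {X N M L p q} → Decomposition X N L p → Decomposition X M L q → Decomposition X (N + M) L (p +ₚ q)
    sum D E = record
      { terms   = terms D ++ terms E
      ; isTerm  = Allₚ.++⁺ (isTerm D) (isTerm E)
      ; few     = ℕₚ.≤-trans (ℕₚ.≤-reflexive (Listₚ.length-++ (terms D))) (ℕₚ.+-mono-≤ (few D) (few E))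
      ; correct = Pₚ.trans (Pₚ.+-cong (correct D) (correct E)) (Pₚ.sym (total-++ (terms D) (terms E))) }

    product : ∀ {X Y N M L K p q} → Disjoint X Y → Decomposition X N L p → Decomposition Y M K q →
      Decomposition (X ∪ Y) (N * M) (L + K) (p *ₚ q)
    product {X} {Y} {L = L} {K} d D E = record
      { terms   = cartesianProductWith _++_ (terms D) (terms E)
      ; isTerm  = isTerms (isTerm D)
      ; few     = ℕₚ.≤-trans (ℕₚ.≤-reflexive (length-product (terms D) (terms E))) (ℕₚ.*-mono-≤ (few D) (few E))
      ; correct = Pₚ.trans (Pₚ.*-cong (correct D) (correct E)) (Pₚ.sym (total-product (terms D) (terms E))) }
      where
      isTerms : ∀ {σs} → All (IsTerm X L) σs →
        All (IsTerm (X ∪ Y) (L + K)) (cartesianProductWith _++_ σs (terms E))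
      isTerms []             = []
      isTerms (σ-ok ∷ σs-ok) = Allₚ.++⁺ (Allₚ.map⁺ (All.map (isTerm-++ d σ-ok) (isTerm E))) (isTerms σs-ok)

    single : ∀ {S g} → IsSmall (S , g) → IsTerm S 1 ((S , g) ∷ [])
    single {S} sg = record
      { small = sg ∷ [] ; disjoint = [] ∷ [] ; inside-X = (λ i∈ → i∈) ∷ [] ; short = s≤s z≤n }

    decompose-small : ∀ {S g} → IsSmall (S , g) → Decomposition S 1 1 g
    decompose-small {S} {g} sg = record
      { terms   = ((S , g) ∷ []) ∷ []
      ; isTerm  = single sg ∷ []
      ; few     = s≤s z≤n
      ; correct = Pₚ.sym (Pₚ.trans (Pₚ.+-identityʳ (g *ₚ 1ₚ)) (Pₚ.*-identityʳ g)) }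

    module _ (G : Graph F n k) (sm : SyntacticallyMultilinearᴳ F G) (all-small : ∀ v → ∣ variablesAt F G v ∣ ≤ t) where

      private
        factor : Fin k → Factor
        factor u = variablesAt F G u , polynomialAt F G u

        factor-small : ∀ u → IsSmall (factor u)
        factor-small u = all-small u , polynomialAt-supported G sm u

        child-variables : ∀ o us {u} → u ∈ˡ toList us →
          variablesAt F G u ⊆ variablesAt F (gate o us ∷ G) zero
        child-variables o us u∈us i∈ = ∈-⋃⁺ (Anyₚ.map⁺ (Any.map (λ where refl → i∈) u∈us))

      -- A sum gives many terms of one factor, a product one term of many factors. The fan-in bounds
      -- both numbers in either case.
      decompose-gate : ∀ o us → SyntacticallyMultilinearᴳ F (gate o us ∷ G) →
        Decomposition (variablesAt F (gate o us ∷ G) zero) (List⁺.length us) (List⁺.length us)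
          (polynomialAt F (gate o us ∷ G) zero)
      decompose-gate ⊕ us _ = record
        { terms   = map (λ u → factor u ∷ []) (toList us)
        ; isTerm  = Allₚ.map⁺ (All.tabulate λ {u} u∈us →
            isTerm-mono (child-variables ⊕ us u∈us) (s≤s z≤n) (single (factor-small u)))
        ; few     = ℕₚ.≤-reflexive (Listₚ.length-map _ (toList us))
        ; correct = sums (toList us) }
        where
        sums : ∀ us → foldr _+ₚ_ 0ₚ (map (polynomialAt F G) us) ≈ₚ total (map (λ u → factor u ∷ []) us)
        sums []       = Pₚ.refl
        sums (u ∷ us) = Pₚ.+-cong (Pₚ.sym (Pₚ.*-identityʳ (polynomialAt F G u))) (sums us)
      decompose-gate ⊗ us (ds , _) = record
        { terms   = map factor (toList us) ∷ []
        ; isTerm  = record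
            { small    = Allₚ.map⁺ (All.universal factor-small (toList us))
            ; disjoint = AllPairsₚ.map⁺ (AllPairsₚ.map⁻ ds)
            ; inside-X = Allₚ.map⁺ (All.tabulate {P = Inside _ ∘ factor} (child-variables ⊗ us))
            ; short    = ℕₚ.≤-reflexive (Listₚ.length-map factor (toList us)) } ∷ []
        ; few     = s≤s z≤n
        ; correct = Pₚ.sym (Pₚ.trans (Pₚ.+-identityʳ (value (map factor (toList us))))
            (Pₚ.reflexive (cong (foldr _*ₚ_ 1ₚ) (≡.sym (Listₚ.map-∘ {g = proj₂} {f = factor} (toList us)))))) }

    record LowestBig {k} (G : Graph F n k) : Set (c ⊔ ℓ₁) where
      field
        w           : Fin k
        big         : t < ∣ variablesAt F G w ∣
        0<fanIn     : 0 < fanInAt G w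
        decomposed  : Decomposition (variablesAt F G w) (fanInAt G w) (fanInAt G w) (polynomialAt F G w)

    -- The tail, which contains all children, is searched first. A leaf has at most one variable, so
    -- `1 ≤ t` forces the vertex found to be a gate, with at least one edge to save.
    lowestBig : 1 ≤ t → ∀ {k} (G : Graph F n k) → SyntacticallyMultilinearᴳ F G →
      (∀ v → ∣ variablesAt F G v ∣ ≤ t) ⊎ LowestBig G
    lowestBig 1≤t []      _  = inj₁ λ ()
    lowestBig 1≤t (N ∷ G) sm with lowestBig 1≤t G (sm-tail N sm)
    ... | inj₂ low = inj₂ record { w = suc w ; big = big ; 0<fanIn = 0<fanIn ; decomposed = decomposed }
      where open LowestBig low
    ... | inj₁ all-small with ∣ variablesAt F (N ∷ G) zero ∣ ≤? t
    ... | yes small = inj₁ λ where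
      zero    → small
      (suc v) → all-small v
    ... | no big = inj₂ (atGate N sm big)
      where
      atGate : ∀ N → SyntacticallyMultilinearᴳ F (N ∷ G) → ¬ ∣ variablesAt F (N ∷ G) zero ∣ ≤ t → LowestBig (N ∷ G)
      atGate (var i)     sm big = contradiction (ℕₚ.≤-trans (ℕₚ.≤-reflexive (Subsetₚ.∣⁅x⁆∣≡1 i)) 1≤t) big
      atGate (const a)   sm big = contradiction (ℕₚ.≤-trans (ℕₚ.≤-reflexive (Subsetₚ.∣⊥∣≡0 n)) z≤n) big
      atGate (gate o us) sm big = record
        { w = zero ; big = ℕₚ.≰⇒> big ; 0<fanIn = s≤s z≤n
        ; decomposed = decompose-gate G (sm-tail (gate o us) sm) all-small o us sm }

    module _ (1≤t : 1 ≤ t) where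

      private
        -- The recursion for the number of terms: factoring out (1 + e₁) ^ r leaves 1 + e₁ + `fan`,
        -- which is exactly 1 + e.
        count-step : ∀ fan e e₁ e₂ r → fan + e₁ ≡ e → e₂ ≤ e₁ →
          suc e₁ ^ suc r + suc e₂ ^ r * fan ≤ suc e ^ suc r
        count-step fan e e₁ e₂ r refl e₂≤e₁ = begin
          suc e₁ ^ suc r + suc e₂ ^ r * fan
            ≤⟨ ℕₚ.+-monoʳ-≤ (suc e₁ ^ suc r) (ℕₚ.*-monoˡ-≤ fan (ℕₚ.^-monoˡ-≤ r (s≤s e₂≤e₁))) ⟩
          suc e₁ * suc e₁ ^ r + suc e₁ ^ r * fan
            ≡⟨ cong (suc e₁ * suc e₁ ^ r +_) (ℕₚ.*-comm (suc e₁ ^ r) fan) ⟩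
          suc e₁ * suc e₁ ^ r + fan * suc e₁ ^ r
            ≡⟨ ℕₚ.*-distribʳ-+ (suc e₁ ^ r) (suc e₁) fan ⟨
          (suc e₁ + fan) * suc e₁ ^ r
            ≡⟨ cong (_* suc e₁ ^ r) (cong suc (ℕₚ.+-comm e₁ fan)) ⟩
          suc (fan + e₁) * suc e₁ ^ r
            ≤⟨ ℕₚ.*-monoʳ-≤ (suc (fan + e₁)) (ℕₚ.^-monoˡ-≤ r (s≤s (ℕₚ.m≤n+m e₁ fan))) ⟩
          suc (fan + e₁) ^ suc r ∎
          where open ℕₚ.≤-Reasoning

      -- `fuel` is needed because the recursive calls act on modified graphs; the decreasing measure
      -- is the number of edges. `r` bounds the quotients still possible, each of which removes more
      -- than t variables from the output.
      decompose′ : ∀ fuel {k} (G : Graph F n k) v r → edges F G < fuel → SyntacticallyMultilinearᴳ F G →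
        ∣ variablesAt F G v ∣ ≤ r * t + t →
        Decomposition (variablesAt F G v) (suc (edges F G) ^ r) (suc (edges F G)) (polynomialAt F G v)
      decompose′ (suc fuel) G v r e<fuel sm ∣X∣≤ with ∣ variablesAt F G v ∣ ≤? t
      ... | yes small = weaken (λ i∈ → i∈) (ℕₚ.m^n>0 (suc (edges F G)) r) (s≤s z≤n) Pₚ.refl
        (decompose-small (small , polynomialAt-supported G sm v))
      ... | no big with lowestBig 1≤t G sm
      ... | inj₁ all-small = contradiction (all-small v) big
      ... | inj₂ low = step r ∣X∣≤
        where
        open LowestBig low renaming (big to w-big)
        fan = fanInAt G w
        e₁ = edges F (erase G w)
        e₂ = edges F (quotient G w)

        e₁<e : e₁ < edges F G
        e₁<e = ℕₚ.≤-trans (ℕₚ.+-monoˡ-≤ e₁ 0<fanIn) (ℕₚ.≤-reflexive (edges-erase G w))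

        e₁<fuel : e₁ < fuel
        e₁<fuel = ℕₚ.≤-trans e₁<e (s≤s⁻¹ e<fuel)

        erased : ∀ r → ∣ variablesAt F G v ∣ ≤ r * t + t →
          Decomposition (variablesAt F G v) (suc e₁ ^ r) (suc (edges F G)) (polynomialAt F (erase G w) v)
        erased r ∣X∣≤ = weaken (erase-variables G w v) ℕₚ.≤-refl (s≤s (ℕₚ.<⇒≤ e₁<e)) Pₚ.refl
          (decompose′ fuel (erase G w) v r e₁<fuel (erase-sm G w sm)
            (ℕₚ.≤-trans (Subsetₚ.p⊆q⇒∣p∣≤∣q∣ (erase-variables G w v)) ∣X∣≤))

        step : ∀ r → ∣ variablesAt F G v ∣ ≤ r * t + t →
          Decomposition (variablesAt F G v) (suc (edges F G) ^ r) (suc (edges F G)) (polynomialAt F G v)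
        step zero    ∣X∣≤ = contradiction ∣X∣≤ big
        step (suc r) ∣X∣≤ with above? G w v
        -- The output does not depend on w, so erasing w costs nothing and saves edges without using
        -- up a quotient.
        ... | no ¬a = weaken (λ i∈ → i∈) (ℕₚ.^-monoˡ-≤ (suc r) (s≤s (ℕₚ.<⇒≤ e₁<e))) ℕₚ.≤-refl
          (Pₚ.reflexive (≡.sym (erase-¬above G w v ¬a))) (erased (suc r) ∣X∣≤)
        ... | yes a = weaken (λ i∈ → i∈)
          (count-step fan (edges F G) e₁ e₂ r (edges-erase G w) (edges-quotient G w)) ℕₚ.≤-refl
          (quotient-above G w v sm (0<∣p∣⇒nonempty _ (ℕₚ.≤-trans (s≤s z≤n) w-big)) a)
          (sum (erased (suc r) ∣X∣≤)
            (weaken union⊆ ℕₚ.≤-refl lengths Pₚ.refl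
              (product disj
                (decompose′ fuel (quotient G w) v r (ℕₚ.≤-trans (s≤s (edges-quotient G w)) e₁<fuel)
                  (quotient-sm G w sm) ∣X′∣≤)
                decomposed)))
          where
          X X′ W : Subset n
          X = variablesAt F G v
          X′ = variablesAt F (quotient G w) v
          W = variablesAt F G w

          disj : Disjoint X′ W
          disj = quotient-disjoint G w v sm a

          union⊆ : X′ ∪ W ⊆ X
          union⊆ i∈ = [ quotient-variables G w v , above-variables G w v a ]′ (Subsetₚ.x∈p∪q⁻ X′ W i∈)

          -- The factors contributed by w are also paid for by its own edges.
          lengths : suc e₂ + fan ≤ suc (edges F G)
          lengths = s≤s (ℕₚ.≤-trans (ℕₚ.+-monoˡ-≤ fan (edges-quotient G w))
            (ℕₚ.≤-reflexive (≡.trans (ℕₚ.+-comm e₁ fan) (edges-erase G w))))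

          ∣X′∣≤ : ∣ X′ ∣ ≤ r * t + t
          ∣X′∣≤ = ℕₚ.+-cancelʳ-≤ t _ _ (begin
            ∣ X′ ∣ + t         ≤⟨ ℕₚ.+-monoʳ-≤ ∣ X′ ∣ (ℕₚ.<⇒≤ w-big) ⟩
            ∣ X′ ∣ + ∣ W ∣     ≤⟨ disjoint-∣∪∣ X′ W disj ⟩
            ∣ X′ ∪ W ∣           ≤⟨ Subsetₚ.p⊆q⇒∣p∣≤∣q∣ union⊆ ⟩
            ∣ X ∣                ≤⟨ ∣X∣≤ ⟩
            suc r * t + t    ≡⟨ cong (_+ t) (ℕₚ.+-comm t (r * t)) ⟩
            r * t + t + t  ∎)
            where open ℕₚ.≤-Reasoning

      decompose : ∀ {k} (G : Graph F n k) v r → SyntacticallyMultilinearᴳ F G →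
        ∣ variablesAt F G v ∣ ≤ r * t + t →
        Decomposition (variablesAt F G v) (suc (edges F G) ^ r) (suc (edges F G)) (polynomialAt F G v)
      decompose G v r = decompose′ (suc (edges F G)) G v r ℕₚ.≤-refl

  -- Construction of layered circuits

  record LayeredGraph (n k : ℕ) : Set c where
    constructor layeredGraph
    field
      graph   : Graph F n k
      layer   : Fin k → Fin 4
      layered : LayeredBy F layer graph
      sm      : SyntacticallyMultilinearᴳ F graph
  open LayeredGraph

  -- `placed` mirrors the condition on children in `LayeredBy`: a leaf may stand at any level.
  record Represents {n k} (G : LayeredGraph n k) (v : Fin k) (l : ℕ) (S : Subset n) (p : Poly n) : Set c where
    field
      polynomial : polynomialAt F (graph G) v ≡ p
      variables  : variablesAt F (graph G) v ⊆ S
      placed     : IsLeaf F (graph G) v ⊎ toℕ (layer G v) ≡ l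
  open Represents

  record _↪_ {n k k′} (G : LayeredGraph n k) (H : LayeredGraph n k′) : Set c where
    field
      embed     : Fin k → Fin k′
      preserves : ∀ {l S p v} → Represents G v l S p → Represents H (embed v) l S p
  open _↪_

  ↪-refl : ∀ {k} {G : LayeredGraph n k} → G ↪ G
  ↪-refl = record { embed = λ v → v ; preserves = λ r → r }

  ↪-trans : ∀ {k k′ k″} {G : LayeredGraph n k} {H : LayeredGraph n k′} {J : LayeredGraph n k″} →
    G ↪ H → H ↪ J → G ↪ J
  ↪-trans f g = record { embed = embed g ∘ embed f ; preserves = λ r → preserves g (preserves f r) }

  -- Composed with `suc` this reduces to the old layering, so the proof for the tail is reused as it
  -- is.
  consLayer : ∀ {k} → Fin 4 → (Fin k → Fin 4) → Fin (suc k) → Fin 4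
  consLayer l ls zero    = l
  consLayer l ls (suc v) = ls v

  ↪-cons : ∀ {k} {G : LayeredGraph n k} {N : Node F n k} {l layered′ sm′} →
    G ↪ layeredGraph (N ∷ graph G) (consLayer l (layer G)) layered′ sm′
  ↪-cons = record
    { embed     = suc
    ; preserves = λ r → record { polynomial = polynomial r ; variables = variables r ; placed = placed r } }

  record Extension {n k} (G : LayeredGraph n k) (l : ℕ) (S : Subset n) (p : Poly n) (e : ℕ) : Set c where
    field
      {vertices} : ℕ
      extended   : LayeredGraph n vertices
      old        : G ↪ extended
      new        : Fin vertices
      represents : Represents extended new l S p
      size≤      : edges F (graph extended) ≤ e + edges F (graph G)

  -- Quantifying over the starting graph makes constructions composable: each one is stacked on the
  -- result of the previous, whose vertices survive through `old`.
  Buildable : ℕ → Subset n → Poly n → ℕ → Set c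
  Buildable {n} l S p e = ∀ {k} (G : LayeredGraph n k) → Extension G l S p e

  buildable-mono : ∀ {l S S′ p e e′} → S ⊆ S′ → e ≤ e′ → Buildable {n} l S p e → Buildable l S′ p e′
  buildable-mono S⊆S′ e≤e′ build G = record
    { extended   = extended
    ; old        = old
    ; new        = new
    ; represents = record
        { polynomial = polynomial represents
        ; variables  = λ i∈ → S⊆S′ (variables represents i∈)
        ; placed     = placed represents }
    ; size≤      = ℕₚ.≤-trans size≤ (ℕₚ.+-monoˡ-≤ (edges F (graph G)) e≤e′) }
    where open Extension (build G)

  build-const : ∀ l a → Buildable {n} l Subset.⊥ (constᴾ F a) 0
  build-const l a G = record
    { extended   = layeredGraph (const a ∷ graph G) (consLayer zero (layer G)) (layered G) (sm G)
    ; old        = ↪-cons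
    ; new        = zero
    ; represents = record { polynomial = refl ; variables = λ i∈ → i∈ ; placed = inj₁ tt }
    ; size≤      = ℕₚ.≤-refl }

  build-var : ∀ l i → Buildable {n} l ⁅ i ⁆ (varᴾ F i) 0
  build-var l i G = record
    { extended   = layeredGraph (var i ∷ graph G) (consLayer zero (layer G)) (layered G) (sm G)
    ; old        = ↪-cons
    ; new        = zero
    ; represents = record { polynomial = refl ; variables = λ i∈ → i∈ ; placed = inj₁ tt }
    ; size≤      = ℕₚ.≤-refl }

  Item : ℕ → Set c
  Item n = Subset n × Poly n

  _represents_at_ : ∀ {k} (G : LayeredGraph n k) → List (Item n) → ℕ → List (Fin k) → Set c
  (G represents xs at l) vs = Pointwise (λ v (S , p) → Represents G v l S p) vs xs

  BuildableItem : ℕ → ℕ → Item n → Set c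
  BuildableItem l e (S , p) = Buildable l S p e

  record Extensions {n k} (G : LayeredGraph n k) (l : ℕ) (xs : List (Item n)) (e : ℕ) : Set c where
    field
      {vertices} : ℕ
      extended   : LayeredGraph n vertices
      old        : G ↪ extended
      new        : List (Fin vertices)
      represents : (extended represents xs at l) new
      size≤      : edges F (graph extended) ≤ e + edges F (graph G)

  build-all : ∀ {l e xs} → All (BuildableItem {n} l e) xs → ∀ {k} (G : LayeredGraph n k) →
    Extensions G l xs (length xs * e)
  build-all []                             G = record
    { extended = G ; old = ↪-refl ; new = [] ; represents = [] ; size≤ = ℕₚ.≤-refl }
  build-all {e = e} (_∷_ {xs = xs} build builds) G = record
    { extended   = Rest.extended
    ; old        = ↪-trans First.old Rest.old
    ; new        = embed Rest.old First.new ∷ Rest.new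
    ; represents = preserves Rest.old First.represents ∷ Rest.represents
    ; size≤      = begin
        edges F (graph Rest.extended)                                  ≤⟨ Rest.size≤ ⟩
        length xs * e + edges F (graph First.extended)             ≤⟨ ℕₚ.+-monoʳ-≤ (length xs * e) First.size≤ ⟩
        length xs * e + (e + edges F (graph G))                  ≡⟨ ℕₚ.+-assoc (length xs * e) e _ ⟨
        length xs * e + e + edges F (graph G)                    ≡⟨ cong (_+ edges F (graph G)) (ℕₚ.+-comm (length xs * e) e) ⟩
        e + length xs * e + edges F (graph G)                    ∎ }
    where
    module First = Extension (build G)
    module Rest = Extensions (build-all builds First.extended)
    open ℕₚ.≤-Reasoning

  opᴾ : Op → List (Poly n) → Poly n
  opᴾ ⊕ = foldr _+ₚ_ 0ₚ
  opᴾ ⊗ = foldr _*ₚ_ 1ₚ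

  Compatible : Op → List (Item n) → Set c
  Compatible ⊕ xs = ⊤ₗ
  Compatible ⊗ xs = AllPairs (Disjoint on proj₁) xs

  module _ {n k} (G : LayeredGraph n k) {l : ℕ} where

    represents-polynomials : ∀ {xs vs} → (G represents xs at l) vs → map (polynomialAt F (graph G)) vs ≡ map proj₂ xs
    represents-polynomials []       = refl
    represents-polynomials (r ∷ rs) = cong₂ _∷_ (polynomial r) (represents-polynomials rs)

    represents-variables : ∀ {xs vs} → (G represents xs at l) vs →
      ⋃ (map (variablesAt F (graph G)) vs) ⊆ ⋃ (map proj₁ xs)
    represents-variables []                      i∈ = i∈
    represents-variables (_∷_ {x = v} {xs = vs} r rs) i∈ = Subsetₚ.x∈p∪q⁺
      ([ inj₁ ∘ (λ i∈ → variables r i∈) , inj₂ ∘ (λ i∈ → represents-variables rs i∈) ]′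
        (Subsetₚ.x∈p∪q⁻ (variablesAt F (graph G) v) (⋃ (map (variablesAt F (graph G)) vs)) i∈))

    represents-disjoint : ∀ {xs vs} → (G represents xs at l) vs → AllPairs (Disjoint on proj₁) xs →
      AllPairs Disjoint (map (variablesAt F (graph G)) vs)
    represents-disjoint []       []       = []
    represents-disjoint (_∷_ {v} {x} r rs) (d ∷ ds) = from rs d ∷ represents-disjoint rs ds
      where
      from : ∀ {xs vs} → (G represents xs at l) vs → All ((Disjoint on proj₁) x) xs →
        All (Disjoint (variablesAt F (graph G) v)) (map (variablesAt F (graph G)) vs)
      from []       []       = []
      from (s ∷ rs) (d ∷ ds) = disjoint-mono (λ i∈ → variables r i∈) (λ i∈ → variables s i∈) d ∷ from rs ds

    represents-placed : ∀ {xs vs} → (G represents xs at l) vs →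
      All (λ v → IsLeaf F (graph G) v ⊎ toℕ (layer G v) ≡ l) vs
    represents-placed []       = []
    represents-placed (r ∷ rs) = placed r ∷ represents-placed rs

  addGate : ∀ {k} (G : LayeredGraph n k) l o {xs v vs} → o ≡ layerOp l → Compatible o xs →
    (G represents xs at suc (toℕ l)) (v ∷ vs) → LayeredGraph n (suc k)
  addGate G l o {xs} {v} {vs} o≡ ok rs = layeredGraph (gate o (v ∷ vs) ∷ graph G) (consLayer l (layer G))
    (o≡ , represents-placed G rs , layered G) (gate-sm o ok)
    where
    gate-sm : ∀ o → Compatible o xs → SyntacticallyMultilinearᴳ F (gate o (v ∷ vs) ∷ graph G)
    gate-sm ⊕ _  = sm G
    gate-sm ⊗ ds = represents-disjoint G rs ds , sm G

  addGate-polynomial : ∀ {k} (G : LayeredGraph n k) l o {xs v vs} (o≡ : o ≡ layerOp l) (ok : Compatible o xs)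
    (rs : (G represents xs at suc (toℕ l)) (v ∷ vs)) →
    polynomialAt F (graph (addGate G l o o≡ ok rs)) zero ≡ opᴾ o (map proj₂ xs)
  addGate-polynomial G l ⊕ o≡ ok rs = cong (foldr _+ₚ_ 0ₚ) (represents-polynomials G rs)
  addGate-polynomial G l ⊗ o≡ ok rs = cong (foldr _*ₚ_ 1ₚ) (represents-polynomials G rs)

  unit : Op → Carrier
  unit ⊕ = 0#
  unit ⊗ = 1#

  opᴾ-[] : ∀ o → constᴾ F (unit o) ≡ opᴾ {n} o []
  opᴾ-[] ⊕ = refl
  opᴾ-[] ⊗ = refl

  build-gate : ∀ l o {e xs} → o ≡ layerOp l → Compatible o xs → All (BuildableItem {n} (suc (toℕ l)) e) xs →
    Buildable (toℕ l) (⋃ (map proj₁ xs)) (opᴾ o (map proj₂ xs)) (length xs * suc e)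
  -- A gate must have a child, so an empty sum or product is realised by a constant leaf without
  -- edges.
  build-gate {n} l o {e} {[]} o≡ ok [] G =
    ≡.subst (λ p → Extension G (toℕ l) Subset.⊥ p 0) (opᴾ-[] o) (build-const (toℕ l) (unit o) G)
  build-gate {n} l o {e} {xs@(_ ∷ _)} o≡ ok builds G with build-all builds G
  ... | record { extended = H ; old = old ; new = v ∷ vs ; represents = rs ; size≤ = size≤ } = record
    { extended   = addGate H l o o≡ ok rs
    ; old        = ↪-trans old ↪-cons
    ; new        = zero
    ; represents = record
        { polynomial = addGate-polynomial H l o o≡ ok rs
        ; variables  = represents-variables H rs
        ; placed     = inj₂ refl }
    ; size≤      = begin
        length (v ∷ vs) + edges F (graph H)
          ≡⟨ cong (_+ edges F (graph H)) (Pointwise.Pointwise-length rs) ⟩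
        length xs + edges F (graph H)
          ≤⟨ ℕₚ.+-monoʳ-≤ (length xs) size≤ ⟩
        length xs + (length xs * e + edges F (graph G))
          ≡⟨ ℕₚ.+-assoc (length xs) (length xs * e) _ ⟨
        length xs + length xs * e + edges F (graph G)
          ≡⟨ cong (_+ edges F (graph G)) (ℕₚ.*-suc (length xs) e) ⟨
        length xs * suc e + edges F (graph G) ∎ }
    where open ℕₚ.≤-Reasoning

  build-monomialᴾ : ∀ a (T : Subset n) → Buildable 3 T (monomialᴾ a T) (suc ∣ T ∣)
  build-monomialᴾ {n} a T = ≡.subst (λ p → Buildable 3 T p (suc ∣ T ∣)) polynomials
    (buildable-mono {S = ⋃ (map proj₁ items)} ⊆T (ℕₚ.≤-reflexive count)
      (build-gate (suc (suc (suc zero))) ⊗ refl disjoint-items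
        -- Level 4 lies below the last layer, but only leaves are put there.
        (build-const 4 a ∷ Allₚ.map⁺ (All.universal (build-var 4) (elements T)))))
    where
    items : List (Item n)
    items = (Subset.⊥ , constᴾ F a) ∷ map (λ i → ⁅ i ⁆ , varᴾ F i) (elements T)

    polynomials : opᴾ ⊗ (map proj₂ items) ≡ monomialᴾ a T
    polynomials = cong (λ ps → constᴾ F a *ₚ foldr _*ₚ_ 1ₚ ps) (≡.sym (Listₚ.map-∘ (elements T)))

    count : length items * 1 ≡ suc ∣ T ∣
    count = ≡.trans (ℕₚ.*-identityʳ _) (cong suc (≡.trans (Listₚ.length-map _ (elements T)) (length-elements T)))

    disjoint-items : AllPairs (Disjoint on proj₁) items
    disjoint-items =
      All.universal (λ _ → disjoint⁺ λ i∈ _ → Subsetₚ.∉⊥ i∈) _ ∷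
      AllPairsₚ.map⁺ (AllPairs.map (λ {i} {j} i≢j → disjoint⁺ λ x∈i x∈j →
        i≢j (≡.trans (≡.sym (Subsetₚ.x∈⁅y⁆⇒x≡y i x∈i)) (Subsetₚ.x∈⁅y⁆⇒x≡y j x∈j))) (elements-distinct T))

    ⊆T : ⋃ (map proj₁ items) ⊆ T
    ⊆T i∈ with ∈-⋃⁻ (map proj₁ items) i∈
    ... | here i∈⊥ = contradiction i∈⊥ Subsetₚ.∉⊥
    ... | there i∈s with All.lookupAny (elements-∈ T) (Anyₚ.map⁻ (Anyₚ.map⁻ i∈s))
    ... | j∈T , i∈j = ≡.subst (_∈ T) (≡.sym (Subsetₚ.x∈⁅y⁆⇒x≡y _ i∈j)) j∈T

  ⋃-⊆ : ∀ {S : Subset n} {ps} → All (_⊆ S) ps → ⋃ ps ⊆ S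
  ⋃-⊆ {ps = ps} ps⊆S i∈ = let p⊆S , i∈p = All.lookupAny ps⊆S (∈-⋃⁻ ps i∈) in p⊆S i∈p

  build-normalForm : ∀ (S : Subset n) g → Buildable 2 S (normalForm S g) (normalFormSize ∣ S ∣)
  build-normalForm {n} S g = ≡.subst (λ p → Buildable 2 S p (normalFormSize ∣ S ∣)) polynomials
    (buildable-mono {S = ⋃ (map proj₁ items)}
      (⋃-⊆ (Allₚ.map⁺ (Allₚ.map⁺ {f = item} (subsets-⊆ S)))) (ℕₚ.≤-reflexive count)
      (build-gate (suc (suc zero)) ⊕ refl _ (Allₚ.map⁺ (All.map {P = _⊆ S} build-item (subsets-⊆ S)))))
    where
    item : Subset n → Item n
    item T = T , monomialᴾ (coeff F g (indicator T)) T

    items : List (Item n)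
    items = map item (subsets S)

    build-item : ∀ {T} → T ⊆ S → BuildableItem 3 (suc ∣ S ∣) (item T)
    build-item {T} T⊆S = buildable-mono (λ i∈ → i∈) (s≤s (Subsetₚ.p⊆q⇒∣p∣≤∣q∣ T⊆S)) (build-monomialᴾ _ T)

    polynomials : opᴾ ⊕ (map proj₂ items) ≡ normalForm S g
    polynomials = cong (foldr _+ₚ_ 0ₚ) (≡.sym (Listₚ.map-∘ (subsets S)))

    count : length items * suc (suc ∣ S ∣) ≡ normalFormSize ∣ S ∣
    count = cong (_* suc (suc ∣ S ∣)) (≡.trans (Listₚ.length-map item (subsets S)) (length-subsets S))

  normalizeItem : Item n → Item n
  normalizeItem (S , g) = S , normalForm S g

  build-term : ∀ {t X L τ} → IsTerm {n} t X L τ →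
    Buildable 1 X (opᴾ ⊗ (map proj₂ (map normalizeItem τ))) (L * suc (normalFormSize t))
  build-term {n} {t} {X} {L} {τ} τ-ok = buildable-mono {S = ⋃ (map proj₁ (map normalizeItem τ))}
    (⋃-⊆ (Allₚ.map⁺ (Allₚ.map⁺ {f = normalizeItem} (inside-X τ-ok))))
    (ℕₚ.*-monoˡ-≤ (suc (normalFormSize t))
      (ℕₚ.≤-trans (ℕₚ.≤-reflexive (Listₚ.length-map normalizeItem τ)) (short τ-ok)))
    (build-gate (suc zero) ⊗ refl (AllPairsₚ.map⁺ (disjoint τ-ok))
      (Allₚ.map⁺ (All.map {Q = BuildableItem 2 (normalFormSize t) ∘ normalizeItem} build-factor (IsTerm.small τ-ok))))
    where
    build-factor : ∀ {σ} → IsSmall t σ → BuildableItem 2 (normalFormSize t) (normalizeItem σ)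
    build-factor {S , g} (S-small , _) =
      buildable-mono {S = S} (λ i∈ → i∈) (normalFormSize-mono S-small) (build-normalForm S g)

  record DepthFour (p : Poly n) (s : ℕ) : Set (c ⊔ ℓ₁) where
    field
      circuit  : Circuit F n
      isΣΠΣΠ   : IsΣΠΣΠ F circuit
      isSM     : SyntacticallyMultilinear F circuit
      computes : polynomialAt F (Circuit.graph circuit) (Circuit.output circuit) ≈ₚ p
      size≤    : size F circuit ≤ s

  depthFour : ∀ {t X T L p} → Decomposition {n} t X T L p → DepthFour p (depthFourSize T L t)
  depthFour {n} {t} {X} {T} {L} {p} D = fromExtensions (build-all builds empty)
    where
    empty : LayeredGraph n 0
    empty = layeredGraph [] (λ ()) _ _

    normalized : List (Factor {n} t) → Poly n
    normalized τ = opᴾ ⊗ (map proj₂ (map normalizeItem τ))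

    item : List (Factor {n} t) → Item n
    item τ = X , normalized τ

    -- The extra summand 0 makes sure that the output is a gate.
    items : List (Item n)
    items = (Subset.⊥ , 0ₚ) ∷ map item (terms D)

    E : ℕ
    E = L * suc (normalFormSize t)

    builds : All (BuildableItem 1 E) items
    builds = buildable-mono (λ i∈ → i∈) z≤n (build-const 1 0#) ∷ Allₚ.map⁺ (All.map build-term (isTerm D))

    normalized-correct : ∀ {τ} → All (IsSmall {n} t) τ → normalized τ ≈ₚ value t τ
    normalized-correct []                        = Pₚ.refl
    normalized-correct {(S , g) ∷ τ} ((_ , supported) ∷ τ-small) =
      Pₚ.*-cong (Pₚ.sym (≈-normalForm supported)) (normalized-correct τ-small)

    sums : ∀ {τs} → All (IsTerm t X L) τs → foldr _+ₚ_ 0ₚ (map proj₂ (map item τs)) ≈ₚ total t τs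
    sums []             = Pₚ.refl
    sums (τ-ok ∷ τs-ok) = Pₚ.+-cong (normalized-correct (small τ-ok)) (sums τs-ok)

    fromExtensions : Extensions empty 1 items (length items * E) → DepthFour p (depthFourSize T L t)
    fromExtensions record { extended = H ; new = v ∷ vs ; represents = rs ; size≤ = size≤ } = record
      { circuit  = record { graph = graph top ; output = zero }
      ; isΣΠΣΠ   = layer top , layered top , (λ ()) , refl
      ; isSM     = sm top
      ; computes = Pₚ.trans (Pₚ.reflexive (addGate-polynomial H zero ⊕ refl _ rs))
          (Pₚ.trans (Pₚ.+-identityˡ _) (Pₚ.trans (sums (isTerm D)) (Pₚ.sym (correct D))))
      ; size≤    = begin
          length (v ∷ vs) + edges F (graph H)      ≡⟨ cong (_+ edges F (graph H)) (Pointwise.Pointwise-length rs) ⟩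
          length items + edges F (graph H)         ≤⟨ ℕₚ.+-monoʳ-≤ (length items) size≤ ⟩
          length items + (length items * E + 0) ≡⟨ cong (length items +_) (ℕₚ.+-identityʳ _) ⟩
          length items + length items * E        ≡⟨ ℕₚ.*-suc (length items) E ⟨
          length items * suc E
            ≤⟨ ℕₚ.*-monoˡ-≤ (suc E) (s≤s (ℕₚ.≤-trans (ℕₚ.≤-reflexive (Listₚ.length-map item (terms D))) (few D))) ⟩
          suc T * suc E                            ∎ }
      where
      open ℕₚ.≤-Reasoning
      top = addGate H zero ⊕ refl _ rs

-- The degree bound and the contradiction with the depth-four hypothesis

sum≤n : ∀ {n} (m : Monomial n) → (∀ i → lookup m i ≤ 1) → Vec.sum m ≤ n
sum≤n []      _  = z≤n
sum≤n (x ∷ m) ≤1 = ℕₚ.+-mono-≤ (≤1 zero) (sum≤n m (≤1 ∘ suc))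

-- Supplies `R ≤ n` in the choice of parameters, without which `t * R` would not be linear in n.
degree≤n : ∀ {c ℓ₁ ℓ₂} (F : HeytingField c ℓ₁ ℓ₂) {n} (f : Polynomial F n) {d} →
  Multilinear F f → HasDegree F f d → d ≤ n
degree≤n F f multilinear ((m , coeff≢0 , refl) , _) = sum≤n m (multilinear m coeff≢0)

corollary1p9 : ∀ {c ℓ₁ ℓ₂} (F : HeytingField c ℓ₁ ℓ₂)
    (f : (n : ℕ) → Polynomial F n) (d : ℕ → ℕ) →
    (∀ n → Multilinear F (f n)) →
    (∀ n → HasDegree F (f n) (d n)) →
    IsωOf-n/log-n d →
    (∃[ p ] ∃[ q ] NonZero p × NonZero q × Eventually (λ n →
    (C : Circuit F n) → IsΣΠΣΠ F C → SyntacticallyMultilinear F C →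
    Computes F C (f n) → PowerOfRootBounds n (d n) p q (size F C))) →
    ∀ k → Eventually (λ n →
    (C : Circuit F n) → SyntacticallyMultilinear F C →
    Computes F C (f n) → n ^ k ≤ size F C)
corollary1p9 F f d multilinear degree ω (p , q , p≢0 , q≢0 , N₀ , lowerBound) k =
  suc (N₀ + N₁) , λ n N<n C C-sm C-computes →
    -- The exponent k + 1 is positive even for k = 0, as the parameters require, and n ≥ 1 allows
    -- the return to k.
    ℕₚ.≤-trans (ℕₚ.^-monoʳ-≤ n {{>-nonZero (ℕₚ.≤-trans (s≤s z≤n) N<n)}} (ℕₚ.n≤1+n k))
      (ℕₚ.≮⇒≥ (impossible n N<n C C-sm C-computes))
  where
  instance
    _ : NonZero p
    _ = p≢0
    _ : NonZero q
    _ = q≢0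

  N₁ : ℕ
  N₁ = proj₁ (ω (growth (suc k) q))

  impossible : ∀ n → N₀ + N₁ < n → (C : Circuit F n) → SyntacticallyMultilinear F C →
    Computes F C (f n) → ¬ size F C < n ^ suc k
  impossible n N<n C C-sm C-computes small-C =
    -- The strict bound on the size says 1 + s ≤ n ^ (k + 1), precisely what the number of terms and
    -- the number of factors call for.
    ℕₚ.<⇒≱ (depthFour< (ℕₚ.^-monoˡ-≤ r small-C) small-C) (ℕₚ.≤-trans
      (lowerBound n (ℕₚ.≤-trans (ℕₚ.m≤m+n N₀ N₁) (ℕₚ.<⇒≤ N<n)) circuit isΣΠΣΠ isSM
        (λ m → HeytingField.trans F (≈ₚ⇒≈ᴾ F computes m) (C-computes m)) (stride (suc k) q * suc r) q exponents)
      (ℕₚ.^-monoˡ-≤ q size≤))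
    where
    open Parameters (parameters (suc k) q n (d n) (ℕₚ.≤-trans (s≤s z≤n) N<n) (degree≤n F (f n) (multilinear n) (degree n))
      (proj₂ (ω (growth (suc k) q)) n (ℕₚ.≤-trans (ℕₚ.m≤n+m N₁ N₀) (ℕₚ.<⇒≤ N<n))))

    open DepthFour (depthFour F (decompose F t 1≤t (Circuit.graph C) (Circuit.output C) r C-sm
      (ℕₚ.≤-trans (Subsetₚ.∣p∣≤n (variablesAt F (Circuit.graph C) (Circuit.output C))) n≤)))

    -- The constant p / q is weakened to 1 / q, using p ≥ 1.
    exponents : (stride (suc k) q * suc r * q) ^ 2 ≤ (p * q) ^ 2 * d n
    exponents = begin
      (stride (suc k) q * suc r * q) ^ 2       ≡⟨ ^-distribʳ-* (stride (suc k) q * suc r) q 2 ⟩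
      (stride (suc k) q * suc r) ^ 2 * q ^ 2   ≤⟨ ℕₚ.*-mono-≤ root≤ (ℕₚ.^-monoˡ-≤ 2 (ℕₚ.m≤n*m q p)) ⟩
      d n * (p * q) ^ 2                      ≡⟨ ℕₚ.*-comm (d n) ((p * q) ^ 2) ⟩
      (p * q) ^ 2 * d n                      ∎
      where open ℕₚ.≤-Reasoning
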